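{- In MLTT°, if $\Gamma \vdash \Pi_{x:A}B \equiv \Pi_{x:A'}B' : \mathcal{U}$, then $\Gamma\vdash A\equiv A':\mathcal{U}$ and $\Gamma, x:A\vdash B\equiv B':\mathcal{U}$.
   Context: MLTT° is the following type theory (dependent products and one universe with type-in-type). Terms are $M,N,A,B ::= x \mid \mathcal{U} \mid \Pi_{x:A}B \mid \lambda_{x:A}M \mid M\,N$, up to $\alpha$-equivalence, with capture-avoiding substitution $M[N/x]$. Contexts are finite lists of declarations $x:A$. The judgements $\vdash\Gamma$ (well-formed context), $\Gamma\vdash M:A$ (typing) and $\Gamma\vdash M\equiv N:A$ (definitional equality) are mutually inductively generated by the following rules. Contexts: the empty context is well-formed; if $\vdash\Gamma$ and $\Gamma\vdash A:\mathcal{U}$ then $\vdash\Gamma,x:A$ ($x$ fresh). Typing: (Var) if $\vdash\Gamma$ and $(x:A)\in\Gamma$ then $\Gamma\vdash x:A$. (Univ) if $\vdash\Gamma$ then $\Gamma\vdash\mathcal{U}:\mathcal{U}$. (Pi) if $\Gamma\vdash A:\mathcal{U}$ and $\Gamma,x:A\vdash B:\mathcal{U}$ then $\Gamma\vdash\Pi_{x:A}B:\mathcal{U}$. (Lam) if $\Gamma\vdash A:\mathcal{U}$ and $\Gamma,x:A\vdash M:B$ then $\Gamma\vdash\lambda_{x:A}M:\Pi_{x:A}B$. (App) if $\Gamma\vdash M:\Pi_{x:A}B$ and $\Gamma\vdash N:A$ then $\Gamma\vdash M\,N:B[N/x]$. (Conv) if $\Gamma\vdash M:A$ and $\Gamma\vdash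 A\equiv B:\mathcal{U}$ then $\Gamma\vdash M:B$. Definitional equality: reflexivity on well-typed terms, symmetry, transitivity; conversion (if $\Gamma\vdash M\equiv N:A$ and $\Gamma\vdash A\equiv B:\mathcal{U}$ then $\Gamma\vdash M\equiv N:B$); congruence rules for $\Pi$, $\lambda$ and application; ($\beta$) if $\Gamma\vdash A:\mathcal{U}$, $\Gamma,x:A\vdash M:B$ and $\Gamma\vdash N:A$ then $\Gamma\vdash(\lambda_{x:A}M)\,N\equiv M[N/x]:B[N/x]$; ($\eta$) if $\Gamma\vdash M:\Pi_{x:A}B$, $\Gamma\vdash N:\Pi_{x:A}B$ and $\Gamma,x:A\vdash M\,x\equiv N\,x:B$ ($x$ fresh) then $\Gamma\vdash M\equiv N:\Pi_{x:A}B$. -}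

module Defs where

open import Data.Fin using (Fin; zero; suc)
open import Data.Nat using (ℕ; zero; suc)

infix  4 _⊢_∶_ _⊢_≐_∶_
infix  5 ⊢_
infixl 6 _▸_
infixl 8 _·_
infix  9 _[_]

-- Well-scoped de Bruijn syntax represents terms up to α-equivalence: Tm n has
-- its free variables in Fin n, and in Π A B and ƛ A M the second argument
-- binds variable zero.
data Tm (n : ℕ) : Set where
  var : Fin n → Tm n
  𝒰   : Tm n
  Π   : Tm n → Tm (suc n) → Tm n
  ƛ   : Tm n → Tm (suc n) → Tm n
  _·_ : Tm n → Tm n → Tm n

Ren : ℕ → ℕ → Set
Ren m n = Fin m → Fin n

liftRen : ∀ {m n} → Ren m n → Ren (suc m) (suc n)
liftRen ρ zero    = zero
liftRen ρ (suc i) = suc (ρ i)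

ren : ∀ {m n} → Ren m n → Tm m → Tm n
ren ρ (var i) = var (ρ i)
ren ρ 𝒰       = 𝒰
ren ρ (Π A B) = Π (ren ρ A) (ren (liftRen ρ) B)
ren ρ (ƛ A M) = ƛ (ren ρ A) (ren (liftRen ρ) M)
ren ρ (M · N) = ren ρ M · ren ρ N

wk : ∀ {n} → Tm n → Tm (suc n)
wk = ren suc

Sub : ℕ → ℕ → Set
Sub m n = Fin m → Tm n

liftSub : ∀ {m n} → Sub m n → Sub (suc m) (suc n)
liftSub σ zero    = var zero
liftSub σ (suc i) = wk (σ i)

sub : ∀ {m n} → Sub m n → Tm m → Tm n
sub σ (var i) = σ i
sub σ 𝒰       = 𝒰
sub σ (Π A B) = Π (sub σ A) (sub (liftSub σ) B)
sub σ (ƛ A M) = ƛ (sub σ A) (sub (liftSub σ) M)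
sub σ (M · N) = sub σ M · sub σ N

inst : ∀ {n} → Tm n → Sub (suc n) n
inst N zero    = N
inst N (suc i) = var i

_[_] : ∀ {n} → Tm (suc n) → Tm n → Tm n
M [ N ] = sub (inst N) M

data Ctx : ℕ → Set where
  ε   : Ctx zero
  _▸_ : ∀ {n} → Ctx n → Tm n → Ctx (suc n)

-- Each declared type lives over the preceding declarations only, so it is
-- weakened to the scope of the whole context.
lookup : ∀ {n} → Ctx n → Fin n → Tm n
lookup (Γ ▸ A) zero    = wk A
lookup (Γ ▸ A) (suc i) = wk (lookup Γ i)

data ⊢_ : ∀ {n} → Ctx n → Set
data _⊢_∶_ {n} (Γ : Ctx n) : Tm n → Tm n → Set
-- Γ ⊢ M ≐ N ∶ A is definitional equality, written ≐ to keep ≡ for Agda's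
-- propositional equality.
data _⊢_≐_∶_ {n} (Γ : Ctx n) : Tm n → Tm n → Tm n → Set

data ⊢_ where
  ⊢ε : ⊢ ε
  ⊢▸ : ∀ {n} {Γ : Ctx n} {A} → ⊢ Γ → Γ ⊢ A ∶ 𝒰 → ⊢ (Γ ▸ A)

data _⊢_∶_ {n} Γ where
  ⊢var  : ⊢ Γ → ∀ i → Γ ⊢ var i ∶ lookup Γ i
  ⊢𝒰    : ⊢ Γ → Γ ⊢ 𝒰 ∶ 𝒰
  ⊢Π    : ∀ {A B} → Γ ⊢ A ∶ 𝒰 → Γ ▸ A ⊢ B ∶ 𝒰 → Γ ⊢ Π A B ∶ 𝒰
  ⊢ƛ    : ∀ {A B M} → Γ ⊢ A ∶ 𝒰 → Γ ▸ A ⊢ M ∶ B → Γ ⊢ ƛ A M ∶ Π A B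
  ⊢·    : ∀ {A B M N} → Γ ⊢ M ∶ Π A B → Γ ⊢ N ∶ A → Γ ⊢ M · N ∶ B [ N ]
  ⊢conv : ∀ {A B M} → Γ ⊢ M ∶ A → Γ ⊢ A ≐ B ∶ 𝒰 → Γ ⊢ M ∶ B

data _⊢_≐_∶_ {n} Γ where
  ≐refl  : ∀ {A M} → Γ ⊢ M ∶ A → Γ ⊢ M ≐ M ∶ A
  ≐sym   : ∀ {A M N} → Γ ⊢ M ≐ N ∶ A → Γ ⊢ N ≐ M ∶ A
  ≐trans : ∀ {A M N P} → Γ ⊢ M ≐ N ∶ A → Γ ⊢ N ≐ P ∶ A → Γ ⊢ M ≐ P ∶ A
  ≐conv  : ∀ {A B M N} → Γ ⊢ M ≐ N ∶ A → Γ ⊢ A ≐ B ∶ 𝒰 → Γ ⊢ M ≐ N ∶ B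
  ≐Π     : ∀ {A A′ B B′} →
           Γ ⊢ A ≐ A′ ∶ 𝒰 → Γ ▸ A ⊢ B ≐ B′ ∶ 𝒰 →
           Γ ⊢ Π A B ≐ Π A′ B′ ∶ 𝒰
  ≐ƛ     : ∀ {A A′ B M M′} →
           Γ ⊢ A ≐ A′ ∶ 𝒰 → Γ ▸ A ⊢ M ≐ M′ ∶ B →
           Γ ⊢ ƛ A M ≐ ƛ A′ M′ ∶ Π A B
  ≐·     : ∀ {A B M M′ N N′} →
           Γ ⊢ M ≐ M′ ∶ Π A B → Γ ⊢ N ≐ N′ ∶ A →
           Γ ⊢ M · N ≐ M′ · N′ ∶ B [ N ]
  ≐β     : ∀ {A B M N} →
           Γ ⊢ A ∶ 𝒰 → Γ ▸ A ⊢ M ∶ B → Γ ⊢ N ∶ A →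
           Γ ⊢ ƛ A M · N ≐ M [ N ] ∶ B [ N ]
  ≐η     : ∀ {A B M N} →
           Γ ⊢ M ∶ Π A B → Γ ⊢ N ∶ Π A B →
           Γ ▸ A ⊢ wk M · var zero ≐ wk N · var zero ∶ B →
           Γ ⊢ M ≐ N ∶ Π A B

{-# OPTIONS --safe #-}
module Submission where

open import Data.Empty using (⊥; ⊥-elim)
open import Data.Fin using (Fin; zero; suc)
open import Data.List using (List; []; _∷_; _++_)
open import Data.List.Membership.Propositional using (_∈_; find; lose)
open import Data.List.Membership.Propositional.Properties using (∈-++⁺ˡ; ∈-++⁺ʳ)
open import Data.List.Relation.Unary.All as All using (All; []; _∷_)
open import Data.List.Relation.Unary.All.Properties using (++⁺)
open import Data.List.Relation.Unary.Any using (Any; here; there)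
open import Data.Nat using (ℕ; zero; suc)
open import Data.Product using (_×_; _,_; proj₁; proj₂; ∃; ∃₂)
open import Data.Unit using (⊤; tt)
open import Function using (_∘_; id)
open import Relation.Binary.PropositionalEquality
  using (_≡_; refl; sym; trans; cong; cong₂; subst; subst₂; _≗_)
open import Defs

-- There is no normalisation in the presence of 𝒰 : 𝒰, so a logical relation
-- cannot be defined by recursion on types.  It is defined instead by recursion
-- on the finite elements of a domain model.  Terms are interpreted in a filter
-- model: ⟦ M ⟧ ρ is a set of atoms, an atom being one finite piece of
-- information (M is 𝒰; M is a Π-type; its domain, resp. its codomain at an
-- argument having the atoms V, has the atom α; M sends such an argument to a
-- term having the atom α).  Definitionally equal terms have the same atoms up to the
-- order ≤.  The relation R α M M′ A, by recursion on α, says that M and M′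
-- weak-head reduce as α predicts, with definitionally equal components, and
-- the fundamental lemma gives R α M N A for M ≐ N ∶ A and every atom α of M.
-- Since Π A B has the atom π, the theorem is the fundamental lemma for the
-- identity substitution, at the environment in which no variable has any atom.
-- Such an environment imposes nothing on the variables, so neutral terms need
-- no treatment and the relation lives over one fixed context.

private
  variable
    k m n : ℕ

-- Substitution calculus

liftSub-cong : {σ τ : Sub m n} → σ ≗ τ → liftSub σ ≗ liftSub τ
liftSub-cong e zero    = refl
liftSub-cong e (suc i) = cong wk (e i)

sub-cong : {σ τ : Sub m n} → σ ≗ τ → sub σ ≗ sub τ
sub-cong e (var i) = e i
sub-cong e 𝒰       = refl
sub-cong e (Π A B) = cong₂ Π (sub-cong e A) (sub-cong (liftSub-cong e) B)
sub-cong e (ƛ A M) = cong₂ ƛ (sub-cong e A) (sub-cong (liftSub-cong e) M)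
sub-cong e (M · N) = cong₂ _·_ (sub-cong e M) (sub-cong e N)

-- The lift of `var` is only pointwise equal to `var`, so the hypothesis is a pointwise equation,
-- which survives binders. The fusion lemmas below have this form for the same reason.
sub-var : {σ : Sub n n} → σ ≗ var → sub σ ≗ id
sub-var e (var i) = e i
sub-var e 𝒰       = refl
sub-var e (Π A B) = cong₂ Π (sub-var e A) (sub-var (λ { zero → refl ; (suc i) → cong wk (e i) }) B)
sub-var e (ƛ A M) = cong₂ ƛ (sub-var e A) (sub-var (λ { zero → refl ; (suc i) → cong wk (e i) }) M)
sub-var e (M · N) = cong₂ _·_ (sub-var e M) (sub-var e N)

ren-ren : {ξ : Ren k m} {ζ : Ren m n} {χ : Ren k n} → ζ ∘ ξ ≗ χ → ren ζ ∘ ren ξ ≗ ren χ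
ren-ren e (var i) = cong var (e i)
ren-ren e 𝒰       = refl
ren-ren e (Π A B) = cong₂ Π (ren-ren e A) (ren-ren (λ { zero → refl ; (suc i) → cong suc (e i) }) B)
ren-ren e (ƛ A M) = cong₂ ƛ (ren-ren e A) (ren-ren (λ { zero → refl ; (suc i) → cong suc (e i) }) M)
ren-ren e (M · N) = cong₂ _·_ (ren-ren e M) (ren-ren e N)

sub-ren : {ξ : Ren k m} {σ : Sub m n} {τ : Sub k n} → σ ∘ ξ ≗ τ → sub σ ∘ ren ξ ≗ sub τ
sub-ren e (var i) = e i
sub-ren e 𝒰       = refl
sub-ren e (Π A B) = cong₂ Π (sub-ren e A) (sub-ren (λ { zero → refl ; (suc i) → cong wk (e i) }) B)
sub-ren e (ƛ A M) = cong₂ ƛ (sub-ren e A) (sub-ren (λ { zero → refl ; (suc i) → cong wk (e i) }) M)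
sub-ren e (M · N) = cong₂ _·_ (sub-ren e M) (sub-ren e N)

wk-ren : (ξ : Ren m n) (M : Tm m) → ren (liftRen ξ) (wk M) ≡ wk (ren ξ M)
wk-ren ξ M = trans (ren-ren (λ _ → refl) M) (sym (ren-ren (λ _ → refl) M))

ren-sub : {σ : Sub k m} {ξ : Ren m n} {τ : Sub k n} → ren ξ ∘ σ ≗ τ → ren ξ ∘ sub σ ≗ sub τ

ren-liftSub : {σ : Sub k m} {ξ : Ren m n} {τ : Sub k n} →
              ren ξ ∘ σ ≗ τ → ren (liftRen ξ) ∘ liftSub σ ≗ liftSub τ
ren-liftSub e zero    = refl
ren-liftSub e (suc i) = trans (wk-ren _ _) (cong wk (e i))

ren-sub e (var i) = e i
ren-sub e 𝒰       = refl
ren-sub e (Π A B) = cong₂ Π (ren-sub e A) (ren-sub (ren-liftSub e) B)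
ren-sub e (ƛ A M) = cong₂ ƛ (ren-sub e A) (ren-sub (ren-liftSub e) M)
ren-sub e (M · N) = cong₂ _·_ (ren-sub e M) (ren-sub e N)

wk-sub : (σ : Sub m n) (M : Tm m) → sub (liftSub σ) (wk M) ≡ wk (sub σ M)
wk-sub σ M = trans (sub-ren (λ _ → refl) M) (sym (ren-sub (λ _ → refl) M))

sub-sub : {σ : Sub k m} {τ : Sub m n} {υ : Sub k n} → sub τ ∘ σ ≗ υ → sub τ ∘ sub σ ≗ sub υ

sub-liftSub : {σ : Sub k m} {τ : Sub m n} {υ : Sub k n} →
              sub τ ∘ σ ≗ υ → sub (liftSub τ) ∘ liftSub σ ≗ liftSub υ
sub-liftSub e zero    = refl
sub-liftSub {σ = σ} {τ} e (suc i) = trans (wk-sub τ (σ i)) (cong wk (e i))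

sub-sub e (var i) = e i
sub-sub e 𝒰       = refl
sub-sub e (Π A B) = cong₂ Π (sub-sub e A) (sub-sub (sub-liftSub e) B)
sub-sub e (ƛ A M) = cong₂ ƛ (sub-sub e A) (sub-sub (sub-liftSub e) M)
sub-sub e (M · N) = cong₂ _·_ (sub-sub e M) (sub-sub e N)

infixl 6 _▹_

_▹_ : Sub m n → Tm n → Sub (suc m) n
(σ ▹ N) zero    = N
(σ ▹ N) (suc i) = σ i

ren-[] : (ξ : Ren m n) (B : Tm (suc m)) (N : Tm m) →
         ren ξ (B [ N ]) ≡ ren (liftRen ξ) B [ ren ξ N ]
ren-[] ξ B N = trans (ren-sub (λ _ → refl) B)
                     (sym (sub-ren (λ { zero → refl ; (suc i) → refl }) B))

sub-wk : (σ : Sub (suc m) n) (A : Tm m) → sub σ (wk A) ≡ sub (σ ∘ suc) A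
sub-wk σ = sub-ren (λ _ → refl)

wk-[] : (A N : Tm n) → wk A [ N ] ≡ A
wk-[] A N = trans (sub-wk (inst N) A) (sub-var (λ _ → refl) A)

sub-▹ : (σ : Sub m n) (B : Tm (suc m)) (N : Tm n) → sub (liftSub σ) B [ N ] ≡ sub (σ ▹ N) B
sub-▹ σ B N = sub-sub (λ { zero → refl ; (suc i) → wk-[] (σ i) N }) B

sub-[]-▹ : (σ : Sub m n) (B : Tm (suc m)) (N : Tm m) → sub σ (B [ N ]) ≡ sub (σ ▹ sub σ N) B
sub-[]-▹ σ B N = sub-sub (λ { zero → refl ; (suc i) → refl }) B

sub-[] : (σ : Sub m n) (B : Tm (suc m)) (N : Tm m) →
         sub σ (B [ N ]) ≡ sub (liftSub σ) B [ sub σ N ]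
sub-[] σ B N = trans (sub-[]-▹ σ B N) (sym (sub-▹ σ B (sub σ N)))

-- Renaming and substitution of derivations

private
  variable
    Γ : Ctx m
    Δ : Ctx n

ctx  : ∀ {M A} → Γ ⊢ M ∶ A → ⊢ Γ
ctx (⊢var d _)  = d
ctx (⊢𝒰 d)      = d
ctx (⊢Π d _)    = ctx d
ctx (⊢ƛ d _)    = ctx d
ctx (⊢· d _)    = ctx d
ctx (⊢conv d _) = ctx d

ctx≐ : ∀ {M N A} → Γ ⊢ M ≐ N ∶ A → ⊢ Γ
ctx≐ (≐refl d)    = ctx d
ctx≐ (≐sym d)     = ctx≐ d
ctx≐ (≐trans d _) = ctx≐ d
ctx≐ (≐conv d _)  = ctx≐ d
ctx≐ (≐Π d _)     = ctx≐ d
ctx≐ (≐ƛ d _)     = ctx≐ d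
ctx≐ (≐· d _)     = ctx≐ d
ctx≐ (≐β d _ _)   = ctx d
ctx≐ (≐η d _ _)   = ctx d

-- The congruence rules for Π and ƛ have no typing premise for the domain, so
-- well-formedness of the target context is not carried along under binders;
-- the chain of lifts is recorded instead, and the target context is rebuilt at
-- the leaves from the derivation that the source context is well formed.
data ⊢Ren : Ren m n → Ctx m → Ctx n → Set where
  base : {ξ : Ren m n} → ⊢ Δ → (∀ i → lookup Δ (ξ i) ≡ ren ξ (lookup Γ i)) → ⊢Ren ξ Γ Δ
  lift : ∀ {ξ : Ren m n} {A} → ⊢Ren ξ Γ Δ → ⊢Ren (liftRen ξ) (Γ ▸ A) (Δ ▸ ren ξ A)

ren-lookup : {ξ : Ren m n} → ⊢Ren ξ Γ Δ → ∀ i → lookup Δ (ξ i) ≡ ren ξ (lookup Γ i)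
ren-lookup (base _ e)       i       = e i
ren-lookup (lift {A = A} r) zero    = sym (wk-ren _ A)
ren-lookup (lift r)         (suc i) = trans (cong wk (ren-lookup r i)) (sym (wk-ren _ _))

ren-ctx : {ξ : Ren m n} → ⊢Ren ξ Γ Δ → ⊢ Γ → ⊢ Δ
ren-⊢   : ∀ {ξ : Ren m n} {M A} → ⊢Ren ξ Γ Δ → Γ ⊢ M ∶ A → Δ ⊢ ren ξ M ∶ ren ξ A
ren-≐   : ∀ {ξ : Ren m n} {M N A} → ⊢Ren ξ Γ Δ → Γ ⊢ M ≐ N ∶ A → Δ ⊢ ren ξ M ≐ ren ξ N ∶ ren ξ A

ren-ctx (base d _) _        = d
ren-ctx (lift r)   (⊢▸ d a) = ⊢▸ (ren-ctx r d) (ren-⊢ r a)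

ren-⊢ {Δ = Δ} r (⊢var d i) = subst (Δ ⊢ _ ∶_) (ren-lookup r i) (⊢var (ren-ctx r d) _)
ren-⊢ r (⊢𝒰 d)      = ⊢𝒰 (ren-ctx r d)
ren-⊢ r (⊢Π a b)    = ⊢Π (ren-⊢ r a) (ren-⊢ (lift r) b)
ren-⊢ r (⊢ƛ a b)    = ⊢ƛ (ren-⊢ r a) (ren-⊢ (lift r) b)
ren-⊢ {Δ = Δ} r (⊢· {B = B} {N = N} a b) =
  subst (Δ ⊢ _ ∶_) (sym (ren-[] _ B N)) (⊢· (ren-⊢ r a) (ren-⊢ r b))
ren-⊢ r (⊢conv a e) = ⊢conv (ren-⊢ r a) (ren-≐ r e)

ren-≐ r (≐refl a)    = ≐refl (ren-⊢ r a)
ren-≐ r (≐sym e)     = ≐sym (ren-≐ r e)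
ren-≐ r (≐trans e f) = ≐trans (ren-≐ r e) (ren-≐ r f)
ren-≐ r (≐conv e f)  = ≐conv (ren-≐ r e) (ren-≐ r f)
ren-≐ r (≐Π e f)     = ≐Π (ren-≐ r e) (ren-≐ (lift r) f)
ren-≐ r (≐ƛ e f)     = ≐ƛ (ren-≐ r e) (ren-≐ (lift r) f)
ren-≐ {Δ = Δ} r (≐· {B = B} {N = N} e f) =
  subst (Δ ⊢ _ ≐ _ ∶_) (sym (ren-[] _ B N)) (≐· (ren-≐ r e) (ren-≐ r f))
ren-≐ {Δ = Δ} {ξ = ξ} r (≐β {A} {B} {M} {N} a b c) =
  subst₂ (Δ ⊢ ren ξ (ƛ A M · N) ≐_∶_) (sym (ren-[] _ M N)) (sym (ren-[] _ B N))
    (≐β (ren-⊢ r a) (ren-⊢ (lift r) b) (ren-⊢ r c))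
ren-≐ {Δ = Δ} {ξ = ξ} r (≐η {A = A} {B = B} {M = M} {N = N} a b e) =
  ≐η (ren-⊢ r a) (ren-⊢ r b)
     (subst₂ (λ X Y → Δ ▸ ren ξ A ⊢ X · var zero ≐ Y · var zero ∶ ren (liftRen ξ) B)
             (wk-ren ξ M) (wk-ren ξ N) (ren-≐ (lift r) e))

wk-⊢ : ∀ {C M A} → Γ ⊢ C ∶ 𝒰 → Γ ⊢ M ∶ A → Γ ▸ C ⊢ wk M ∶ wk A
wk-⊢ c = ren-⊢ (base (⊢▸ (ctx c) c) (λ _ → refl))

wk-≐ : ∀ {C M N A} → Γ ⊢ C ∶ 𝒰 → Γ ⊢ M ≐ N ∶ A → Γ ▸ C ⊢ wk M ≐ wk N ∶ wk A
wk-≐ c = ren-≐ (base (⊢▸ (ctx c) c) (λ _ → refl))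

data ⊢Sub : Sub m n → Ctx m → Ctx n → Set where
  base : {σ : Sub m n} → ⊢ Δ → (∀ i → Δ ⊢ σ i ∶ sub σ (lookup Γ i)) → ⊢Sub σ Γ Δ
  lift : ∀ {σ : Sub m n} {A} → ⊢Sub σ Γ Δ → ⊢Sub (liftSub σ) (Γ ▸ A) (Δ ▸ sub σ A)

-- As for renamings, `lift` stores no typing of `A`; the derivation of `⊢ Γ` supplies it, and the
-- mutual recursion descends into that derivation.
sub-lookup : {σ : Sub m n} → ⊢Sub σ Γ Δ → ⊢ Γ → ∀ i → Δ ⊢ σ i ∶ sub σ (lookup Γ i)
sub-ctx : {σ : Sub m n} → ⊢Sub σ Γ Δ → ⊢ Γ → ⊢ Δ
sub-⊢   : ∀ {σ : Sub m n} {M A} → ⊢Sub σ Γ Δ → Γ ⊢ M ∶ A → Δ ⊢ sub σ M ∶ sub σ A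
sub-≐   : ∀ {σ : Sub m n} {M N A} → ⊢Sub σ Γ Δ → Γ ⊢ M ≐ N ∶ A → Δ ⊢ sub σ M ≐ sub σ N ∶ sub σ A

sub-lookup (base _ t) _ i = t i
sub-lookup {Δ = Δ} (lift {A = A} s) (⊢▸ d a) zero =
  subst (Δ ⊢ _ ∶_) (sym (wk-sub _ A)) (⊢var (⊢▸ (sub-ctx s d) (sub-⊢ s a)) zero)
sub-lookup {Γ = Γ ▸ _} {Δ = Δ} (lift s) (⊢▸ d a) (suc i) =
  subst (Δ ⊢ _ ∶_) (sym (wk-sub _ (lookup Γ i))) (wk-⊢ (sub-⊢ s a) (sub-lookup s d i))

sub-ctx (base d _) _        = d
sub-ctx (lift s)   (⊢▸ d a) = ⊢▸ (sub-ctx s d) (sub-⊢ s a)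

sub-⊢ s (⊢var d i)  = sub-lookup s d i
sub-⊢ s (⊢𝒰 d)      = ⊢𝒰 (sub-ctx s d)
sub-⊢ s (⊢Π a b)    = ⊢Π (sub-⊢ s a) (sub-⊢ (lift s) b)
sub-⊢ s (⊢ƛ a b)    = ⊢ƛ (sub-⊢ s a) (sub-⊢ (lift s) b)
sub-⊢ {Δ = Δ} s (⊢· {B = B} {N = N} a b) =
  subst (Δ ⊢ _ ∶_) (sym (sub-[] _ B N)) (⊢· (sub-⊢ s a) (sub-⊢ s b))
sub-⊢ s (⊢conv a e) = ⊢conv (sub-⊢ s a) (sub-≐ s e)

sub-≐ s (≐refl a)    = ≐refl (sub-⊢ s a)
sub-≐ s (≐sym e)     = ≐sym (sub-≐ s e)
sub-≐ s (≐trans e f) = ≐trans (sub-≐ s e) (sub-≐ s f)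
sub-≐ s (≐conv e f)  = ≐conv (sub-≐ s e) (sub-≐ s f)
sub-≐ s (≐Π e f)     = ≐Π (sub-≐ s e) (sub-≐ (lift s) f)
sub-≐ s (≐ƛ e f)     = ≐ƛ (sub-≐ s e) (sub-≐ (lift s) f)
sub-≐ {Δ = Δ} s (≐· {B = B} {N = N} e f) =
  subst (Δ ⊢ _ ≐ _ ∶_) (sym (sub-[] _ B N)) (≐· (sub-≐ s e) (sub-≐ s f))
sub-≐ {Δ = Δ} {σ = σ} s (≐β {A} {B} {M} {N} a b c) =
  subst₂ (Δ ⊢ sub σ (ƛ A M · N) ≐_∶_) (sym (sub-[] _ M N)) (sym (sub-[] _ B N))
    (≐β (sub-⊢ s a) (sub-⊢ (lift s) b) (sub-⊢ s c))
sub-≐ {Δ = Δ} {σ = σ} s (≐η {A = A} {B = B} {M = M} {N = N} a b e) =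
  ≐η (sub-⊢ s a) (sub-⊢ s b)
     (subst₂ (λ X Y → Δ ▸ sub σ A ⊢ X · var zero ≐ Y · var zero ∶ sub (liftSub σ) B)
             (wk-sub σ M) (wk-sub σ N) (sub-≐ (lift s) e))

▹-⊢ : ∀ {σ : Sub m n} {A N} → ⊢Sub σ Γ Δ → ⊢ Γ → Δ ⊢ N ∶ sub σ A → ⊢Sub (σ ▹ N) (Γ ▸ A) Δ
▹-⊢ {Γ = Γ} {Δ = Δ} {σ = σ} {A} s d a = base (ctx a) λ
  { zero    → subst (Δ ⊢ _ ∶_) (sym (sub-wk _ A)) a
  ; (suc i) → subst (Δ ⊢ _ ∶_) (sym (sub-wk _ (lookup Γ i))) (sub-lookup s d i) }

id-⊢ : ⊢ Γ → ⊢Sub var Γ Γ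
id-⊢ {Γ = Γ} d = base d λ i → subst (Γ ⊢ _ ∶_) (sym (sub-var (λ _ → refl) (lookup Γ i))) (⊢var d i)

[]-⊢ : ∀ {A B M N} → Γ ▸ A ⊢ M ∶ B → Γ ⊢ N ∶ A → Γ ⊢ M [ N ] ∶ B [ N ]
[]-⊢ {Γ = Γ} {A} {B} {M} {N} b a =
  subst₂ (Γ ⊢_∶_) (sub-cong var▹ M) (sub-cong var▹ B)
    (sub-⊢ (▹-⊢ (id-⊢ (ctx a)) (ctx a) (subst (Γ ⊢ N ∶_) (sym (sub-var (λ _ → refl) A)) a)) b)
  where
  var▹ : var ▹ N ≗ inst N
  var▹ zero    = refl
  var▹ (suc i) = refl

-- Functionality and presuppositions

record ⊢Sub≐ (σ τ : Sub m n) (Γ : Ctx m) (Δ : Ctx n) : Set where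
  field
    left  : ⊢Sub σ Γ Δ
    equal : ∀ i → Δ ⊢ σ i ≐ τ i ∶ sub σ (lookup Γ i)
open ⊢Sub≐

lift-≐ : ∀ {σ τ : Sub m n} {A} → ⊢Sub≐ σ τ Γ Δ → Γ ⊢ A ∶ 𝒰 →
         ⊢Sub≐ (liftSub σ) (liftSub τ) (Γ ▸ A) (Δ ▸ sub σ A)
lift-≐ s a .left = lift (s .left)
lift-≐ s a .equal zero = ≐refl (sub-lookup (lift (s .left)) (⊢▸ (ctx a) a) zero)
lift-≐ {Γ = Γ} {Δ = Δ} {σ = σ} {A = A} s a .equal (suc i) =
  subst (Δ ▸ sub σ A ⊢ _ ≐ _ ∶_) (sym (wk-sub σ (lookup Γ i)))
    (wk-≐ (sub-⊢ (s .left) a) (s .equal i))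

-- The induction runs over typing derivations; its conversion case only substitutes `σ` into the
-- type equation. The lemma is thus available to `presup`, which has to compare `B [ N ]` with
-- `B [ N′ ]`.
sub-fun : ∀ {σ τ : Sub m n} {M A} → ⊢Sub≐ σ τ Γ Δ → Γ ⊢ M ∶ A → Δ ⊢ sub σ M ≐ sub τ M ∶ sub σ A
sub-fun s (⊢var d i)  = s .equal i
sub-fun s (⊢𝒰 d)      = ≐refl (⊢𝒰 (sub-ctx (s .left) d))
sub-fun s (⊢Π a b)    = ≐Π (sub-fun s a) (sub-fun (lift-≐ s a) b)
sub-fun s (⊢ƛ a b)    = ≐ƛ (sub-fun s a) (sub-fun (lift-≐ s a) b)
sub-fun {Δ = Δ} s (⊢· {B = B} {N = N} a b) =
  subst (Δ ⊢ _ ≐ _ ∶_) (sym (sub-[] _ B N)) (≐· (sub-fun s a) (sub-fun s b))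
sub-fun s (⊢conv a e) = ≐conv (sub-fun s a) (sub-≐ (s .left) e)

▹-≐ : ∀ {σ τ : Sub m n} {A N N′} → ⊢Sub≐ σ τ Γ Δ → ⊢ Γ →
      Δ ⊢ N ∶ sub σ A → Δ ⊢ N ≐ N′ ∶ sub σ A → ⊢Sub≐ (σ ▹ N) (τ ▹ N′) (Γ ▸ A) Δ
▹-≐ s d a e .left = ▹-⊢ (s .left) d a
▹-≐ {Δ = Δ} {A = A} s d a e .equal zero = subst (Δ ⊢ _ ≐ _ ∶_) (sym (sub-wk _ A)) e
▹-≐ {Γ = Γ} {Δ = Δ} s d a e .equal (suc i) =
  subst (Δ ⊢ _ ≐ _ ∶_) (sym (sub-wk _ (lookup Γ i))) (s .equal i)

[]-fun : ∀ {A B M N N′} → Γ ▸ A ⊢ M ∶ B → Γ ⊢ N ∶ A → Γ ⊢ N ≐ N′ ∶ A → Γ ⊢ M [ N ] ≐ M [ N′ ] ∶ B [ N ]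
[]-fun {Γ = Γ} {A} {B} {M} {N} {N′} b a e = sub-fun inst≐ b
  where
  at : ∀ i → Γ ⊢ inst N i ∶ lookup (Γ ▸ A) i [ N ]
  at i = []-⊢ (⊢var (ctx b) i) a
  inst≐ : ⊢Sub≐ (inst N) (inst N′) (Γ ▸ A) Γ
  inst≐ .left = base (ctx a) at
  inst≐ .equal zero = subst (Γ ⊢ N ≐ N′ ∶_) (sym (wk-[] A N)) e
  inst≐ .equal (suc i) = ≐refl (at (suc i))

Π-inv : ∀ {A B C} → Γ ⊢ Π A B ∶ C → (Γ ⊢ A ∶ 𝒰) × (Γ ▸ A ⊢ B ∶ 𝒰)
Π-inv (⊢Π a b)    = a , b
Π-inv (⊢conv d _) = Π-inv d

-- Changing the type of the last variable is substitution by `var`, with variable zero retyped by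
-- conversion.
ctx-conv : ∀ {A A′} → Γ ⊢ A ∶ 𝒰 → Γ ⊢ A′ ∶ 𝒰 → Γ ⊢ A ≐ A′ ∶ 𝒰 → ⊢Sub var (Γ ▸ A) (Γ ▸ A′)
ctx-conv {Γ = Γ} {A} {A′} a a′ e = base d λ i → subst (Γ ▸ A′ ⊢ _ ∶_) (sym (sub-var (λ _ → refl) _)) (at i)
  where
  d = ⊢▸ (ctx a′) a′
  at : ∀ i → Γ ▸ A′ ⊢ var i ∶ lookup (Γ ▸ A) i
  at zero    = ⊢conv (⊢var d zero) (≐sym (wk-≐ a′ e))
  at (suc i) = ⊢var d (suc i)

conv-⊢ : ∀ {A A′ M B} → Γ ⊢ A ∶ 𝒰 → Γ ⊢ A′ ∶ 𝒰 → Γ ⊢ A ≐ A′ ∶ 𝒰 → Γ ▸ A ⊢ M ∶ B → Γ ▸ A′ ⊢ M ∶ B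
conv-⊢ {Γ = Γ} {A′ = A′} a a′ e d =
  subst₂ (Γ ▸ A′ ⊢_∶_) (sub-var (λ _ → refl) _) (sub-var (λ _ → refl) _) (sub-⊢ (ctx-conv a a′ e) d)

conv-≐ : ∀ {A A′ M N B} → Γ ⊢ A ∶ 𝒰 → Γ ⊢ A′ ∶ 𝒰 → Γ ⊢ A ≐ A′ ∶ 𝒰 → Γ ▸ A ⊢ M ≐ N ∶ B → Γ ▸ A′ ⊢ M ≐ N ∶ B
conv-≐ {Γ = Γ} {A′ = A′} {M} {N} {B} a a′ e d =
  subst (λ X → Γ ▸ A′ ⊢ X ≐ N ∶ B) (sub-var (λ _ → refl) M)
    (subst₂ (Γ ▸ A′ ⊢ sub var M ≐_∶_) (sub-var (λ _ → refl) N) (sub-var (λ _ → refl) B)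
      (sub-≐ (ctx-conv a a′ e) d))

lookup-⊢ : ⊢ Γ → ∀ i → Γ ⊢ lookup Γ i ∶ 𝒰
lookup-⊢ (⊢▸ d a) zero    = wk-⊢ a a
lookup-⊢ (⊢▸ d a) (suc i) = wk-⊢ a (lookup-⊢ d i)

type-⊢ : ∀ {M A} → Γ ⊢ M ∶ A → Γ ⊢ A ∶ 𝒰
presup : ∀ {M N A} → Γ ⊢ M ≐ N ∶ A → (Γ ⊢ M ∶ A) × (Γ ⊢ N ∶ A) × (Γ ⊢ A ∶ 𝒰)

type-⊢ (⊢var d i)  = lookup-⊢ d i
type-⊢ (⊢𝒰 d)      = ⊢𝒰 d
type-⊢ (⊢Π a b)    = ⊢𝒰 (ctx a)
type-⊢ (⊢ƛ a b)    = ⊢Π a (type-⊢ b)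
type-⊢ (⊢· a b)    = []-⊢ (proj₂ (Π-inv (type-⊢ a))) b
type-⊢ (⊢conv a e) = proj₁ (proj₂ (presup e))

presup (≐refl a)    = a , a , type-⊢ a
presup (≐sym e)     = let a , b , c = presup e in b , a , c
presup (≐trans e f) = proj₁ (presup e) , proj₂ (presup f)
presup (≐conv e f)  =
  let a , b , _ = presup e ; _ , c , _ = presup f in ⊢conv a f , ⊢conv b f , c
presup (≐Π e f)     =
  let a , a′ , c = presup e ; b , b′ , _ = presup f in ⊢Π a b , ⊢Π a′ (conv-⊢ a a′ e b′) , c
presup (≐ƛ e f)     =
  let a , a′ , _ = presup e ; b , b′ , c = presup f in
  ⊢ƛ a b
  -- The right-hand abstraction naturally has type `Π A′ B`, which is converted back to `Π A B`.
  , ⊢conv (⊢ƛ a′ (conv-⊢ a a′ e b′)) (≐Π (≐sym e) (≐refl (conv-⊢ a a′ e c)))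
  , ⊢Π a c
presup (≐· e f)     =
  let a , a′ , c = presup e ; b , b′ , _ = presup f ; g = proj₂ (Π-inv c) in
  ⊢· a b , ⊢conv (⊢· a′ b′) (≐sym ([]-fun g b f)) , []-⊢ g b
presup (≐β a b c)   = ⊢· (⊢ƛ a b) c , []-⊢ b c , []-⊢ (type-⊢ b) c
presup (≐η a b e)   = a , b , type-⊢ a

-- The filter model

infixr 6 _↦_
infix  4 _≤_ _⊑_ _◂_ _⊆_ _≲_ _≈_

data Atom : Set where
  u π : Atom
  dom : Atom → Atom
  cod : List Atom → Atom → Atom
  _↦_ : List Atom → Atom → Atom

private
  variable
    α β γ : Atom
    U V W : List Atom

-- Contravariance in V is forced by η for functions; for codomains V is kept
-- fixed, as the relation at cod V α contains information about V.
data _≤_ : Atom → Atom → Set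

-- The lower (Hoare) preorder on finite sets of atoms; larger sets carry more information.
_⊑_ : List Atom → List Atom → Set
V ⊑ W = All (λ v → Any (v ≤_) W) V

data _≤_ where
  u   : u ≤ u
  π   : π ≤ π
  dom : α ≤ β → dom α ≤ dom β
  cod : α ≤ β → cod V α ≤ cod V β
  fun : W ⊑ V → α ≤ β → V ↦ α ≤ W ↦ β

≤-refl : ∀ α → α ≤ α
⊑-refl : ∀ V → V ⊑ V

≤-refl u         = u
≤-refl π         = π
≤-refl (dom α)   = dom (≤-refl α)
≤-refl (cod V α) = cod (≤-refl α)
≤-refl (V ↦ α)   = fun (⊑-refl V) (≤-refl α)

⊑-refl []      = []
⊑-refl (v ∷ V) = here (≤-refl v) ∷ All.map there (⊑-refl V)

≤-trans   : α ≤ β → β ≤ γ → α ≤ γ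
⊑-trans   : U ⊑ V → V ⊑ W → U ⊑ W
Any≤-⊑    : Any (α ≤_) V → V ⊑ W → Any (α ≤_) W
≤-Any≤    : α ≤ β → Any (β ≤_) W → Any (α ≤_) W

≤-trans u         u           = u
≤-trans π         π           = π
≤-trans (dom p)   (dom q)     = dom (≤-trans p q)
≤-trans (cod p)   (cod q)     = cod (≤-trans p q)
≤-trans (fun s p) (fun s′ p′) = fun (⊑-trans s′ s) (≤-trans p p′)

⊑-trans []      s = []
⊑-trans (p ∷ r) s = Any≤-⊑ p s ∷ ⊑-trans r s

Any≤-⊑ (here p)  (q ∷ s) = ≤-Any≤ p q
Any≤-⊑ (there p) (q ∷ s) = Any≤-⊑ p s

≤-Any≤ p (here q)  = here (≤-trans p q)
≤-Any≤ p (there q) = there (≤-Any≤ p q)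

Pred : Set₁
Pred = Atom → Set

-- Interpretations are not downward closed in general, since `⟦ ƛ A M ⟧` admits `V ↦ α` only for `V`
-- in the domain. Hence `≲` is inclusion up to `≤`, and `≈` the induced equivalence.
_⊆_ _≲_ _≈_ : Pred → Pred → Set
X ⊆ Y = ∀ {α} → X α → Y α
X ≲ Y = ∀ {α} → X α → ∃ λ β → α ≤ β × Y β
X ≈ Y = X ≲ Y × Y ≲ X

_◂_ : List Atom → Pred → Set
V ◂ X = All (λ v → ∃ λ β → v ≤ β × X β) V

private
  variable
    X Y Z : Pred

⊆⇒≲ : X ⊆ Y → X ≲ Y
⊆⇒≲ s {α} a = α , ≤-refl α , s a

≲-trans : X ≲ Y → Y ≲ Z → X ≲ Z
≲-trans s t a = let _ , p , b = s a ; _ , q , c = t b in _ , ≤-trans p q , c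

◂-≲ : V ◂ X → X ≲ Y → V ◂ Y
◂-≲ v s = All.map (λ (_ , p , a) → let _ , q , b = s a in _ , ≤-trans p q , b) v

◂⇒≲ : V ◂ X → (_∈ V) ≲ X
◂⇒≲ v i = All.lookup v i

⊑⇒◂ : V ⊑ W → V ◂ (_∈ W)
⊑⇒◂ = All.map (λ a → let _ , i , p = find a in _ , p , i)

◂⇒⊑ : V ◂ (_∈ W) → V ⊑ W
◂⇒⊑ = All.map (λ (_ , p , i) → lose i p)

⊑-◂ : V ⊑ W → W ◂ X → V ◂ X
⊑-◂ s w = ◂-≲ (⊑⇒◂ s) (◂⇒≲ w)

All⇒◂ : All X V → V ◂ X
All⇒◂ = All.map (λ {α} a → α , ≤-refl α , a)

-- Ty α X says that α is an element of the type whose set of atoms is X.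

-- The codomain of the type `X` at an argument with the atoms `V`: information promised for `W`
-- applies to every argument that has at least the information `W`.
Cod : List Atom → Pred → Pred
Cod V X γ = ∃ λ W → W ⊑ V × X (cod W γ)

Ty  : Atom → Pred → Set
Tys : List Atom → Pred → Set

Ty u         X = X u
Ty π         X = X u
-- An element with an atom `dom α` is itself a type, and so is its domain, so `α` must belong to the
-- universe, whose only atom is `u`.
Ty (dom α)   X = X u × Ty α (_≡ u)
Ty (cod V α) X = X u × Ty α (_≡ u)
Ty (V ↦ α)   X = X π × Tys V (X ∘ dom) × Ty α (Cod V X)

Tys []      X = ⊤
Tys (v ∷ V) X = Ty v X × Tys V X

Tys-lookup : Tys V X → α ∈ V → Ty α X
Tys-lookup (a , _)  (here refl) = a
Tys-lookup (_ , as) (there i)   = Tys-lookup as i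

Tys-tabulate : ∀ V → (∀ {v} → v ∈ V → Ty v X) → Tys V X
Tys-tabulate []      f = tt
Tys-tabulate (v ∷ V) f = f (here refl) , Tys-tabulate V (f ∘ there)

≲-u : X ≲ Y → X u → Y u
≲-u s a with s a
... | u , u , b = b

≲-π : X ≲ Y → X π → Y π
≲-π s a with s a
... | π , π , b = b

≲-dom : X ≲ Y → X ∘ dom ≲ Y ∘ dom
≲-dom s a with s a
... | dom _ , dom p , b = _ , p , b

≲-Cod : X ≲ Y → Cod V X ≲ Cod V Y
≲-Cod s (W , w , a) with s a
... | cod _ _ , cod p , b = _ , p , W , w , b

Ty-≲  : ∀ α → X ≲ Y → Ty α X → Ty α Y
Tys-≲ : ∀ V → X ≲ Y → Tys V X → Tys V Y

Ty-≲ u         s a       = ≲-u s a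
Ty-≲ π         s a       = ≲-u s a
Ty-≲ (dom α)   s (a , b) = ≲-u s a , b
Ty-≲ (cod V α) s (a , b) = ≲-u s a , b
Ty-≲ (V ↦ α)   s (a , b , c) = ≲-π s a , Tys-≲ V (≲-dom s) b , Ty-≲ α (≲-Cod s) c

Tys-≲ []      s _        = tt
Tys-≲ (v ∷ V) s (a , as) = Ty-≲ v s a , Tys-≲ V s as

-- Interpretation of terms

Env : ℕ → Set₁
Env n = Fin n → Pred

infixl 6 _,,_

_,,_ : Env n → Pred → Env (suc n)
(ρ ,, X) zero    = X
(ρ ,, X) (suc i) = ρ i

⟦_⟧ : Tm n → Env n → Pred
⟦ var i ⟧ ρ α         = ρ i α
⟦ 𝒰 ⟧     ρ α         = α ≡ u
⟦ Π A B ⟧ ρ π         = ⊤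
⟦ Π A B ⟧ ρ (dom α)   = ⟦ A ⟧ ρ α
-- The guard `Tys V` restricts arguments to the domain, so that the environment extended by `V`
-- again respects the context; soundness for the body relies on this.
⟦ Π A B ⟧ ρ (cod V α) = Tys V (⟦ A ⟧ ρ) × ⟦ B ⟧ (ρ ,, (_∈ V)) α
⟦ Π A B ⟧ ρ _         = ⊥
⟦ ƛ A M ⟧ ρ (V ↦ α)   = Tys V (⟦ A ⟧ ρ) × ⟦ M ⟧ (ρ ,, (_∈ V)) α
⟦ ƛ A M ⟧ ρ _         = ⊥
⟦ M · N ⟧ ρ α         = ∃ λ V → ⟦ M ⟧ ρ (V ↦ α) × V ◂ ⟦ N ⟧ ρ

private
  variable
    ρ ρ′ : Env n

⟦⟧-≲ : ∀ (M : Tm n) → (∀ i → ρ i ≲ ρ′ i) → ⟦ M ⟧ ρ ≲ ⟦ M ⟧ ρ′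

,,-≲ : (∀ i → ρ i ≲ ρ′ i) → X ≲ Y → ∀ i → (ρ ,, X) i ≲ (ρ′ ,, Y) i
,,-≲ s t zero    = t
,,-≲ s t (suc i) = s i

⟦⟧-≲ (var i) s a = s i a
⟦⟧-≲ 𝒰       s a = _ , ≤-refl _ , a
⟦⟧-≲ (Π A B) s {π}       a = π , π , tt
⟦⟧-≲ (Π A B) s {dom _}   a = let _ , p , b = ⟦⟧-≲ A s a in _ , dom p , b
⟦⟧-≲ (Π A B) s {cod V _} (v , a) =
  let _ , p , b = ⟦⟧-≲ B (,,-≲ s (⊆⇒≲ id)) a in _ , cod p , Tys-≲ V (⟦⟧-≲ A s) v , b
⟦⟧-≲ (ƛ A M) s {V ↦ _}   (v , a) =
  let _ , p , b = ⟦⟧-≲ M (,,-≲ s (⊆⇒≲ id)) a in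
  _ , fun (⊑-refl V) p , Tys-≲ V (⟦⟧-≲ A s) v , b
⟦⟧-≲ (M · N) s (V , a , v) with ⟦⟧-≲ M s a
... | (W ↦ _) , fun t p , b = _ , p , W , b , ⊑-◂ t (◂-≲ v (⟦⟧-≲ N s))

-- Continuity

⟨_⟩ : (Fin n → List Atom) → Env n
⟨ φ ⟩ i = _∈ φ i

-- Scott continuity of a predicate on environments: each instance already holds for finitely many
-- atoms of each variable.
record Scott (F : Env n → Set) : Set₁ where
  constructor scott
  field
    mono : (∀ i → ρ i ⊆ ρ′ i) → F ρ → F ρ′
    cont : F ρ → ∃ λ φ → (∀ i → All (ρ i) (φ i)) × F ⟨ φ ⟩
open Scott

private
  variable
    S S′ : Env n → Set

Scott-const : ∀ {C : Set} → Scott {n} (λ _ → C)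
Scott-const .mono s c = c
Scott-const .cont c = (λ _ → []) , (λ _ → []) , c

Scott-× : Scott S → Scott S′ → Scott (λ ρ → S ρ × S′ ρ)
Scott-× f g .mono s (a , b) = f .mono s a , g .mono s b
Scott-× f g .cont (a , b) =
  let φ , p , a′ = f .cont a ; ψ , q , b′ = g .cont b in
  (λ i → φ i ++ ψ i) , (λ i → ++⁺ (p i) (q i)) ,
  f .mono (λ i → ∈-++⁺ˡ) a′ , g .mono (λ i → ∈-++⁺ʳ (φ i)) b′

Scott-∃ : ∀ {C : Set} {F : C → Env n → Set} → (∀ c → Scott (F c)) → Scott (λ ρ → ∃ λ c → F c ρ)
Scott-∃ f .mono s (c , a) = c , f c .mono s a
Scott-∃ f .cont (c , a) = let φ , p , a′ = f c .cont a in φ , p , c , a′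

Scott-iff : (∀ ρ → S ρ → S′ ρ) → (∀ ρ → S′ ρ → S ρ) → Scott S → Scott S′
Scott-iff to from f .mono s a = to _ (f .mono s (from _ a))
Scott-iff to from f .cont a = let φ , p , a′ = f .cont (from _ a) in φ , p , to _ a′

Scott-All : ∀ {P : Env n → Pred} → (∀ α → Scott (λ ρ → P ρ α)) → ∀ V → Scott (λ ρ → All (P ρ) V)
Scott-All f [] = Scott-iff (λ _ _ → []) (λ _ _ → tt) Scott-const
Scott-All f (v ∷ V) =
  Scott-iff (λ _ (a , as) → a ∷ as) (λ { _ (a ∷ as) → a , as }) (Scott-× (f v) (Scott-All f V))

Scott-,, : {F : Env (suc n) → Set} → Scott F → Scott (λ ρ → F (ρ ,, X))
Scott-,, f .mono s = f .mono λ { zero → id ; (suc i) → s i }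
Scott-,, f .cont a =
  let φ , p , a′ = f .cont a in
  φ ∘ suc , p ∘ suc , f .mono (λ { zero → All.lookup (p zero) ; (suc i) → id }) a′

single : Fin n → Atom → Fin n → List Atom
single zero    α zero    = α ∷ []
single zero    α (suc _) = []
single (suc i) α zero    = []
single (suc i) α (suc j) = single i α j

single-All : ∀ (i : Fin n) → ρ i α → ∀ j → All (ρ j) (single i α j)
single-All zero    a zero    = a ∷ []
single-All zero    a (suc j) = []
single-All (suc i) a zero    = []
single-All {ρ = ρ} (suc i) a (suc j) = single-All {ρ = ρ ∘ suc} i a j

single-∈ : ∀ (i : Fin n) → α ∈ single i α i
single-∈ zero    = here refl
single-∈ (suc i) = single-∈ i

Scott-var : ∀ (i : Fin n) → Scott (λ ρ → ρ i α)
Scott-var i .mono s a = s i a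
Scott-var {α = α} i .cont {ρ} a = single i α , single-All {ρ = ρ} i a , single-∈ i

Scott-Ty  : ∀ {P : Env n → Pred} α → (∀ β → Scott (λ ρ → P ρ β)) → Scott (λ ρ → Ty α (P ρ))
Scott-Tys : ∀ {P : Env n → Pred} V → (∀ β → Scott (λ ρ → P ρ β)) → Scott (λ ρ → Tys V (P ρ))

Scott-Ty u         f = f u
Scott-Ty π         f = f u
Scott-Ty (dom α)   f = Scott-× (f u) Scott-const
Scott-Ty (cod V α) f = Scott-× (f u) Scott-const
Scott-Ty (V ↦ α)   f =
  Scott-× (f π)
    (Scott-× (Scott-Tys V (f ∘ dom))
             (Scott-Ty α λ β → Scott-∃ λ W → Scott-× Scott-const (f (cod W β))))

Scott-Tys []      f = Scott-const
Scott-Tys (v ∷ V) f = Scott-× (Scott-Ty v f) (Scott-Tys V f)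

Scott-⟦⟧ : ∀ (M : Tm n) α → Scott (λ ρ → ⟦ M ⟧ ρ α)
Scott-⟦⟧ (var i) α         = Scott-var i
Scott-⟦⟧ 𝒰       α         = Scott-const
Scott-⟦⟧ (Π A B) u         = Scott-const
Scott-⟦⟧ (Π A B) π         = Scott-const
Scott-⟦⟧ (Π A B) (dom α)   = Scott-⟦⟧ A α
Scott-⟦⟧ (Π A B) (cod V α) = Scott-× (Scott-Tys V (Scott-⟦⟧ A)) (Scott-,, (Scott-⟦⟧ B α))
Scott-⟦⟧ (Π A B) (V ↦ α)   = Scott-const
Scott-⟦⟧ (ƛ A M) u         = Scott-const
Scott-⟦⟧ (ƛ A M) π         = Scott-const
Scott-⟦⟧ (ƛ A M) (dom α)   = Scott-const
Scott-⟦⟧ (ƛ A M) (cod V α) = Scott-const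
Scott-⟦⟧ (ƛ A M) (V ↦ α)   = Scott-× (Scott-Tys V (Scott-⟦⟧ A)) (Scott-,, (Scott-⟦⟧ M α))
Scott-⟦⟧ (M · N) α         =
  Scott-∃ λ V → Scott-× (Scott-⟦⟧ M (V ↦ α))
    (Scott-All (λ v → Scott-∃ λ β → Scott-× Scott-const (Scott-⟦⟧ N β)) V)

-- Only the last variable is cut down to a finite list; monotonicity restores `ρ` at the others. The
-- list is the argument information `V` needed for an atom `V ↦ α` or `cod V α`.
⟦⟧-cont : ∀ (M : Tm (suc n)) → ⟦ M ⟧ (ρ ,, X) α →
          ∃ λ V → All X V × ⟦ M ⟧ (ρ ,, (_∈ V)) α
⟦⟧-cont M a =
  let φ , p , b = Scott-⟦⟧ M _ .cont a in
  φ zero , p zero ,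
  Scott-⟦⟧ M _ .mono (λ { zero → id ; (suc i) → All.lookup (p (suc i)) }) b

-- Substitution in the model

Tys-⊆ : ∀ V → X ⊆ Y → Tys V X → Tys V Y
Tys-⊆ V s = Tys-≲ V (⊆⇒≲ s)

◂-⊆ : V ◂ X → X ⊆ Y → V ◂ Y
◂-⊆ v s = ◂-≲ v (⊆⇒≲ s)

-- Interpretations occur only positively, also inside `Tys`, so each inclusion has its own induction
-- from an inclusion of environments. The same holds for substitution.
⟦ren⟧⁻ : ∀ {ξ : Ren m n} (M : Tm m) → (∀ i → ρ (ξ i) ⊆ ρ′ i) → ⟦ ren ξ M ⟧ ρ ⊆ ⟦ M ⟧ ρ′
⟦ren⟧⁻ (var i) s a = s i a
⟦ren⟧⁻ 𝒰       s a = a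
⟦ren⟧⁻ (Π A B) s {π}       a = tt
⟦ren⟧⁻ (Π A B) s {dom _}   a = ⟦ren⟧⁻ A s a
⟦ren⟧⁻ (Π A B) s {cod V _} (v , a) =
  Tys-⊆ V (⟦ren⟧⁻ A s) v , ⟦ren⟧⁻ B (λ { zero → id ; (suc i) → s i }) a
⟦ren⟧⁻ (ƛ A M) s {V ↦ _}   (v , a) =
  Tys-⊆ V (⟦ren⟧⁻ A s) v , ⟦ren⟧⁻ M (λ { zero → id ; (suc i) → s i }) a
⟦ren⟧⁻ (M · N) s (V , a , v) = V , ⟦ren⟧⁻ M s a , ◂-⊆ v (⟦ren⟧⁻ N s)

⟦ren⟧⁺ : ∀ {ξ : Ren m n} (M : Tm m) → (∀ i → ρ′ i ⊆ ρ (ξ i)) → ⟦ M ⟧ ρ′ ⊆ ⟦ ren ξ M ⟧ ρ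
⟦ren⟧⁺ (var i) s a = s i a
⟦ren⟧⁺ 𝒰       s a = a
⟦ren⟧⁺ (Π A B) s {π}       a = tt
⟦ren⟧⁺ (Π A B) s {dom _}   a = ⟦ren⟧⁺ A s a
⟦ren⟧⁺ (Π A B) s {cod V _} (v , a) =
  Tys-⊆ V (⟦ren⟧⁺ A s) v , ⟦ren⟧⁺ B (λ { zero → id ; (suc i) → s i }) a
⟦ren⟧⁺ (ƛ A M) s {V ↦ _}   (v , a) =
  Tys-⊆ V (⟦ren⟧⁺ A s) v , ⟦ren⟧⁺ M (λ { zero → id ; (suc i) → s i }) a
⟦ren⟧⁺ (M · N) s (V , a , v) = V , ⟦ren⟧⁺ M s a , ◂-⊆ v (⟦ren⟧⁺ N s)

⟦wk⟧⁻ : ∀ (M : Tm n) {ρ : Env (suc n)} → ⟦ wk M ⟧ ρ ⊆ ⟦ M ⟧ (ρ ∘ suc)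
⟦wk⟧⁻ M = ⟦ren⟧⁻ M (λ _ → id)

⟦wk⟧⁺ : ∀ (M : Tm n) {ρ : Env (suc n)} → ⟦ M ⟧ (ρ ∘ suc) ⊆ ⟦ wk M ⟧ ρ
⟦wk⟧⁺ M = ⟦ren⟧⁺ M (λ _ → id)

⟦sub⟧⁻ : ∀ {σ : Sub m n} (M : Tm m) → (∀ i → ⟦ σ i ⟧ ρ ⊆ ρ′ i) → ⟦ sub σ M ⟧ ρ ⊆ ⟦ M ⟧ ρ′

lift⁻ : ∀ {σ : Sub m n} → (∀ i → ⟦ σ i ⟧ ρ ⊆ ρ′ i) → ∀ i → ⟦ liftSub σ i ⟧ (ρ ,, X) ⊆ (ρ′ ,, X) i
lift⁻ s zero            = id
lift⁻ {σ = σ} s (suc i) = s i ∘ ⟦wk⟧⁻ (σ i)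

⟦sub⟧⁻ (var i) s a = s i a
⟦sub⟧⁻ 𝒰       s a = a
⟦sub⟧⁻ (Π A B) s {π}       a = tt
⟦sub⟧⁻ (Π A B) s {dom _}   a = ⟦sub⟧⁻ A s a
⟦sub⟧⁻ (Π A B) s {cod V _} (v , a) = Tys-⊆ V (⟦sub⟧⁻ A s) v , ⟦sub⟧⁻ B (lift⁻ s) a
⟦sub⟧⁻ (ƛ A M) s {V ↦ _}   (v , a) = Tys-⊆ V (⟦sub⟧⁻ A s) v , ⟦sub⟧⁻ M (lift⁻ s) a
⟦sub⟧⁻ (M · N) s (V , a , v) = V , ⟦sub⟧⁻ M s a , ◂-⊆ v (⟦sub⟧⁻ N s)

⟦sub⟧⁺ : ∀ {σ : Sub m n} (M : Tm m) → (∀ i → ρ′ i ⊆ ⟦ σ i ⟧ ρ) → ⟦ M ⟧ ρ′ ⊆ ⟦ sub σ M ⟧ ρ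

lift⁺ : ∀ {σ : Sub m n} → (∀ i → ρ′ i ⊆ ⟦ σ i ⟧ ρ) → ∀ i → (ρ′ ,, X) i ⊆ ⟦ liftSub σ i ⟧ (ρ ,, X)
lift⁺ s zero            = id
lift⁺ {σ = σ} s (suc i) = ⟦wk⟧⁺ (σ i) ∘ s i

⟦sub⟧⁺ (var i) s a = s i a
⟦sub⟧⁺ 𝒰       s a = a
⟦sub⟧⁺ (Π A B) s {π}       a = tt
⟦sub⟧⁺ (Π A B) s {dom _}   a = ⟦sub⟧⁺ A s a
⟦sub⟧⁺ (Π A B) s {cod V _} (v , a) = Tys-⊆ V (⟦sub⟧⁺ A s) v , ⟦sub⟧⁺ B (lift⁺ s) a
⟦sub⟧⁺ (ƛ A M) s {V ↦ _}   (v , a) = Tys-⊆ V (⟦sub⟧⁺ A s) v , ⟦sub⟧⁺ M (lift⁺ s) a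
⟦sub⟧⁺ (M · N) s (V , a , v) = V , ⟦sub⟧⁺ M s a , ◂-⊆ v (⟦sub⟧⁺ N s)

⟦[]⟧⁻ : ∀ (M : Tm (suc n)) N → ⟦ M [ N ] ⟧ ρ ⊆ ⟦ M ⟧ (ρ ,, ⟦ N ⟧ ρ)
⟦[]⟧⁻ M N = ⟦sub⟧⁻ M (λ { zero → id ; (suc i) → id })

⟦[]⟧⁺ : ∀ (M : Tm (suc n)) N → ⟦ M ⟧ (ρ ,, ⟦ N ⟧ ρ) ⊆ ⟦ M [ N ] ⟧ ρ
⟦[]⟧⁺ M N = ⟦sub⟧⁺ M (λ { zero → id ; (suc i) → id })

-- Soundness of the model

infix 4 _⊨_

_⊨_ : Env n → Ctx n → Set
ρ ⊨ Γ = ∀ i {α} → ρ i α → Ty α (⟦ lookup Γ i ⟧ ρ)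

⊨-,, : ∀ {A} → ρ ⊨ Γ → (∀ {α} → X α → Ty α (⟦ A ⟧ ρ)) → (ρ ,, X) ⊨ Γ ▸ A
⊨-,, {A = A} r t zero    {α} a = Ty-≲ α (⊆⇒≲ (⟦wk⟧⁺ A {_ ,, _})) (t a)
⊨-,, {Γ = Γ} r t (suc i) {α} a = Ty-≲ α (⊆⇒≲ (⟦wk⟧⁺ (lookup Γ i) {_ ,, _})) (r i a)

⊨-∈ : ∀ {A} → ρ ⊨ Γ → Tys V (⟦ A ⟧ ρ) → (ρ ,, (_∈ V)) ⊨ Γ ▸ A
⊨-∈ {A = A} r v = ⊨-,, {A = A} r (Tys-lookup v)

⟦⟧-◂ : ∀ (M : Tm (suc n)) → V ◂ X → ⟦ M ⟧ (ρ ,, (_∈ V)) ≲ ⟦ M ⟧ (ρ ,, X)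
⟦⟧-◂ M v = ⟦⟧-≲ M (,,-≲ (λ _ → ⊆⇒≲ id) (◂⇒≲ v))

Cod-Π : ∀ {A : Tm n} {B N} → V ◂ ⟦ N ⟧ ρ → Cod V (⟦ Π A B ⟧ ρ) ≲ ⟦ B [ N ] ⟧ ρ
Cod-Π {B = B} {N} v (W , w , _ , a) =
  ≲-trans (⟦⟧-◂ B (⊑-◂ w v)) (⊆⇒≲ (⟦[]⟧⁺ B N)) a

-- The two parts are simultaneous: conversion needs equal types to have equivalent atoms, while β
-- and η need the atoms of a term to belong to its type.
sound-Ty : ∀ {M A} → Γ ⊢ M ∶ A → ρ ⊨ Γ → ∀ {α} → ⟦ M ⟧ ρ α → Ty α (⟦ A ⟧ ρ)
sound-≈  : ∀ {M N A} → Γ ⊢ M ≐ N ∶ A → ρ ⊨ Γ → ⟦ M ⟧ ρ ≈ ⟦ N ⟧ ρ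

sound-Ty (⊢var d i) r a = r i a
sound-Ty (⊢𝒰 d) r refl = refl
sound-Ty (⊢Π d e) r {π} _ = refl
sound-Ty (⊢Π d e) r {dom α} a = refl , sound-Ty d r a
sound-Ty (⊢Π d e) r {cod V α} (v , a) = refl , sound-Ty e (⊨-∈ r v) a
sound-Ty (⊢ƛ d e) r {V ↦ α} (v , a) =
  tt , v , Ty-≲ α (⊆⇒≲ (λ b → V , ⊑-refl V , v , b)) (sound-Ty e (⊨-∈ r v) a)
sound-Ty (⊢· {A} {B} {N = N} d e) r {α} (V , a , v) =
  let _ , _ , b = sound-Ty d r a in Ty-≲ α (Cod-Π {A = A} {B} {N} v) b
sound-Ty (⊢conv d e) r {α} a = Ty-≲ α (proj₁ (sound-≈ e r)) (sound-Ty d r a)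

sound-≈ (≐refl d) r = ⊆⇒≲ id , ⊆⇒≲ id
sound-≈ (≐sym e) r = let s , t = sound-≈ e r in t , s
sound-≈ (≐trans e f) r =
  let s , t = sound-≈ e r ; s′ , t′ = sound-≈ f r in ≲-trans s s′ , ≲-trans t′ t
sound-≈ (≐conv e f) r = sound-≈ e r
sound-≈ {ρ = ρ} (≐Π {A} {A′} {B} {B′} e f) r = to , from
  where
  to : ⟦ Π A B ⟧ ρ ≲ ⟦ Π A′ B′ ⟧ ρ
  to {π} _ = π , π , tt
  to {dom α} a = let _ , p , b = proj₁ (sound-≈ e r) a in _ , dom p , b
  to {cod V α} (v , a) =
    let _ , p , b = proj₁ (sound-≈ f (⊨-∈ r v)) a in
    _ , cod p , Tys-≲ V (proj₁ (sound-≈ e r)) v , b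
  from : ⟦ Π A′ B′ ⟧ ρ ≲ ⟦ Π A B ⟧ ρ
  from {π} _ = π , π , tt
  from {dom α} a = let _ , p , b = proj₂ (sound-≈ e r) a in _ , dom p , b
  from {cod V α} (v , a) =
    -- The codomain equation lives over `Γ ▸ A`, so the guard is moved from `A′` to `A` before it is
    -- used.
    let v′ = Tys-≲ V (proj₂ (sound-≈ e r)) v ; _ , p , b = proj₂ (sound-≈ f (⊨-∈ r v′)) a in
    _ , cod p , v′ , b
sound-≈ {ρ = ρ} (≐ƛ {A} {A′} {B} {M} {M′} e f) r = to , from
  where
  to : ⟦ ƛ A M ⟧ ρ ≲ ⟦ ƛ A′ M′ ⟧ ρ
  to {V ↦ α} (v , a) =
    let _ , p , b = proj₁ (sound-≈ f (⊨-∈ r v)) a in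
    _ , fun (⊑-refl V) p , Tys-≲ V (proj₁ (sound-≈ e r)) v , b
  from : ⟦ ƛ A′ M′ ⟧ ρ ≲ ⟦ ƛ A M ⟧ ρ
  from {V ↦ α} (v , a) =
    let v′ = Tys-≲ V (proj₂ (sound-≈ e r)) v ; _ , p , b = proj₂ (sound-≈ f (⊨-∈ r v′)) a in
    _ , fun (⊑-refl V) p , v′ , b
sound-≈ {ρ = ρ} (≐· {M = M} {M′} {N} {N′} e f) r = to , from
  where
  to : ⟦ M · N ⟧ ρ ≲ ⟦ M′ · N′ ⟧ ρ
  to (V , a , v) with proj₁ (sound-≈ e r) a
  ... | W ↦ _ , fun t p , b = _ , p , W , b , ⊑-◂ t (◂-≲ v (proj₁ (sound-≈ f r)))
  from : ⟦ M′ · N′ ⟧ ρ ≲ ⟦ M · N ⟧ ρ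
  from (V , a , v) with proj₂ (sound-≈ e r) a
  ... | W ↦ _ , fun t p , b = _ , p , W , b , ⊑-◂ t (◂-≲ v (proj₂ (sound-≈ f r)))
sound-≈ {ρ = ρ} (≐β {A} {B} {M} {N} d e f) r = to , from
  where
  to : ⟦ ƛ A M · N ⟧ ρ ≲ ⟦ M [ N ] ⟧ ρ
  to (V , (_ , a) , v) = ≲-trans (⟦⟧-◂ M v) (⊆⇒≲ (⟦[]⟧⁺ M N)) a
  from : ⟦ M [ N ] ⟧ ρ ≲ ⟦ ƛ A M · N ⟧ ρ
  from a =
    let V , v , b = ⟦⟧-cont M (⟦[]⟧⁻ M N a) in
    -- The atoms in `V` come from `N`, hence lie in `A` by typing soundness, and the guard of the
    -- abstraction is met.
    _ , ≤-refl _ , V , (Tys-tabulate V (λ i → sound-Ty f r (All.lookup v i)) , b) , All⇒◂ v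
sound-≈ {Γ = Γ} {ρ = ρ} (≐η {A} {B} {M} {N} d e f) r =
  η {M} {N} d (λ v → proj₁ (sound-≈ f (⊨-∈ r v))) , η {N} {M} e (λ v → proj₂ (sound-≈ f (⊨-∈ r v)))
  where
  -- The atoms of a term of type Π A B are of the form V ↦ α, since Π A B does not have the atom u.
  η : ∀ {M N} → Γ ⊢ M ∶ Π A B →
      (∀ {V} → Tys V (⟦ A ⟧ ρ) →
       ⟦ wk M · var zero ⟧ (ρ ,, (_∈ V)) ≲ ⟦ wk N · var zero ⟧ (ρ ,, (_∈ V))) →
      ⟦ M ⟧ ρ ≲ ⟦ N ⟧ ρ
  η d h {u}       a = ⊥-elim (sound-Ty d r a)
  η d h {π}       a = ⊥-elim (sound-Ty d r a)
  η d h {dom _}   a = ⊥-elim (proj₁ (sound-Ty d r a))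
  η d h {cod _ _} a = ⊥-elim (proj₁ (sound-Ty d r a))
  η {M} {N} d h {V ↦ α} a =
    -- Give the new variable exactly the atoms `V`. The equation yields an atom `W ↦ β` of `N` with
    -- `α ≤ β` and `W ⊑ V`, which lies above `V ↦ α` by contravariance.
    let _ , v , _ = sound-Ty d r a
        _ , p , W , b , w = h v (V , ⟦wk⟧⁺ M a , All⇒◂ (All.tabulate id))
    in W ↦ _ , fun (◂⇒⊑ w) p , ⟦wk⟧⁻ N b

-- Weak head reduction

infix 4 _⟶_ _⟶*_

data _⟶_ {n} : Tm n → Tm n → Set where
  ⟶β : ∀ {A M N} → ƛ A M · N ⟶ M [ N ]
  ⟶· : ∀ {M M′ N} → M ⟶ M′ → M · N ⟶ M′ · N

data _⟶*_ {n} : Tm n → Tm n → Set where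
  done : ∀ {M} → M ⟶* M
  _◅_  : ∀ {M N P} → M ⟶ N → N ⟶* P → M ⟶* P

⟶-det : ∀ {M N P : Tm n} → M ⟶ N → M ⟶ P → N ≡ P
⟶-det ⟶β     ⟶β     = refl
⟶-det (⟶· r) (⟶· s) = cong (_· _) (⟶-det r s)

-- A Π-type does not reduce, and reduction is deterministic. Witnesses obtained from different atoms
-- of one term therefore have the same components.
⟶*-Π : ∀ {M : Tm n} {A B A′ B′} → M ⟶* Π A B → M ⟶* Π A′ B′ → Π A B ≡ Π A′ B′
⟶*-Π done    done    = refl
⟶*-Π (r ◅ p) (s ◅ q) with refl ← ⟶-det r s = ⟶*-Π p q

⟶*-trans : ∀ {M N P : Tm n} → M ⟶* N → N ⟶* P → M ⟶* P
⟶*-trans done    q = q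
⟶*-trans (r ◅ p) q = r ◅ ⟶*-trans p q

⟶*-· : ∀ {M M′ N : Tm n} → M ⟶* M′ → M · N ⟶* M′ · N
⟶*-· done    = done
⟶*-· (r ◅ p) = ⟶· r ◅ ⟶*-· p

-- The logical relation

record Π≐ (Δ : Ctx n) (P : Tm n → Tm (suc n) → Tm n → Tm (suc n) → Set) (M M′ : Tm n) : Set where
  constructor Πpair
  field
    {F F′} : Tm n
    {G G′} : Tm (suc n)
    red    : M ⟶* Π F G
    red′   : M′ ⟶* Π F′ G′
    dom≐   : Δ ⊢ F ≐ F′ ∶ 𝒰
    rel    : P F G F′ G′

module _ (Δ : Ctx n) where

  -- T α A A′ is what is needed to transport R α from the type A to A′.  It is a
  -- separate relation because it has to be structurally recursive in α, and the
  -- atoms of A that it amounts to (see Ty) are not subterms of α.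
  T  : Atom → Tm n → Tm n → Set
  R  : Atom → Tm n → Tm n → Tm n → Set
  Ts : List Atom → Tm n → Tm n → Set
  Rs : List Atom → Tm n → Tm n → Tm n → Set

  -- The component `Ts V F F′` allows arguments related at `F` to be retyped at `F′`, as symmetry
  -- and transitivity require.
  Fam : List Atom → (Tm n → Tm n → Set) → Tm n → Tm (suc n) → Tm n → Tm (suc n) → Set
  Fam V Q F G F′ G′ =
    Ts V F F′ × (∀ {N N′} → Δ ⊢ N ≐ N′ ∶ F → Rs V N N′ F → Q (G [ N ]) (G′ [ N′ ]))

  T u         A A′ = ⊤
  T π         A A′ = ⊤
  T (dom α)   A A′ = T α 𝒰 𝒰
  T (cod V α) A A′ = T α 𝒰 𝒰
  T (V ↦ α)   A A′ = Π≐ Δ (Fam V (T α)) A A′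

  R u         M M′ A = (M ⟶* 𝒰) × (M′ ⟶* 𝒰)
  -- Together with `dom≐`, this clause is the conclusion of the theorem for the Π-types that `M` and
  -- `M′` reduce to.
  R π         M M′ A = Π≐ Δ (λ F G F′ G′ → Δ ▸ F ⊢ G ≐ G′ ∶ 𝒰) M M′
  R (dom α)   M M′ A = Π≐ Δ (λ F G F′ G′ → R α F F′ 𝒰) M M′
  R (cod V α) M M′ A = Π≐ Δ (Fam V (λ B B′ → R α B B′ 𝒰)) M M′
  R (V ↦ α)   M M′ A = ∃₂ λ F G → (A ⟶* Π F G) ×
    (∀ {N N′} → Δ ⊢ N ≐ N′ ∶ F → Rs V N N′ F → R α (M · N) (M′ · N′) (G [ N ]))

  Ts []      A A′ = ⊤
  Ts (v ∷ V) A A′ = T v A A′ × Ts V A A′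

  Rs []      M M′ A = ⊤
  Rs (v ∷ V) M M′ A = R v M M′ A × Rs V M M′ A

  TypeRel : Pred → Tm n → Tm n → Set
  TypeRel X A A′ = ∀ {γ} → X γ → R γ A A′ 𝒰

-- Symmetry, transitivity and conversion for the relation

module _ {Δ : Ctx n} where

  private
    variable
      A A′ M M′ M″ N N′ F F′ : Tm n
      G G′ : Tm (suc n)

  Rs-tabulate : ∀ V → (∀ {v} → v ∈ V → R Δ v M M′ A) → Rs Δ V M M′ A
  Rs-tabulate []      f = tt
  Rs-tabulate (v ∷ V) f = f (here refl) , Rs-tabulate V (f ∘ there)

  Rs-lookup : Rs Δ V M M′ A → α ∈ V → R Δ α M M′ A
  Rs-lookup (a , _)  (here refl) = a
  Rs-lookup (_ , as) (there i)   = Rs-lookup as i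

  Symmetric Transitive : (Tm n → Tm n → Set) → Set
  Symmetric Q = ∀ {A A′} → Q A A′ → Q A′ A
  Transitive Q = ∀ {A A′ A″} → Q A A′ → Q A′ A″ → Q A A″

  Π≐-sym : ∀ {P M M′} → (∀ {F G F′ G′} → Δ ⊢ F ≐ F′ ∶ 𝒰 → P F G F′ G′ → P F′ G′ F G) →
           Π≐ Δ P M M′ → Π≐ Δ P M′ M
  Π≐-sym s (Πpair r r′ e p) = Πpair r′ r (≐sym e) (s e p)

  Π≐-trans : ∀ {P M M′ M″} →
             (∀ {F G F′ G′ F″ G″} → Δ ⊢ F ≐ F′ ∶ 𝒰 → P F G F′ G′ → P F′ G′ F″ G″ → P F G F″ G″) →
             Π≐ Δ P M M′ → Π≐ Δ P M′ M″ → Π≐ Δ P M M″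
  Π≐-trans t (Πpair r r′ e p) (Πpair q q′ f o) with refl ← ⟶*-Π r′ q =
    Πpair r q′ (≐trans e f) (t e p o)

  T-sym    : ∀ α → Symmetric (T Δ α)
  T-trans  : ∀ α → Transitive (T Δ α)
  -- At a function atom the result is typed by the left argument, so swapping sides moves it between
  -- `G [ N ]` and `G [ N′ ]`. The hypothesis `T Δ α A A` says that the codomain permits this.
  R-sym    : ∀ α → T Δ α A A → R Δ α M M′ A → R Δ α M′ M A
  R-trans  : ∀ α → T Δ α A A → R Δ α M M′ A → R Δ α M′ M″ A → R Δ α M M″ A
  R-conv   : ∀ α → T Δ α A A′ → R Δ α M M′ A → R Δ α M M′ A′
  Ts-sym   : ∀ V → Symmetric (Ts Δ V)
  Ts-trans : ∀ V → Transitive (Ts Δ V)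
  Rs-sym   : ∀ V → Ts Δ V A A → Rs Δ V M M′ A → Rs Δ V M′ M A
  Rs-trans : ∀ V → Ts Δ V A A → Rs Δ V M M′ A → Rs Δ V M′ M″ A → Rs Δ V M M″ A
  Rs-conv  : ∀ V → Ts Δ V A A′ → Rs Δ V M M′ A → Rs Δ V M M′ A′

  -- Abstract in `Q`, to serve both `T` at `V ↦ α` and `R` at `cod V α`.
  ΠFam-sym   : ∀ V Q → Symmetric Q → Symmetric (Π≐ Δ (Fam Δ V Q))
  ΠFam-trans : ∀ V Q → Transitive Q → Transitive (Π≐ Δ (Fam Δ V Q))

  Ts-left : ∀ V → Ts Δ V A A′ → Ts Δ V A A
  Ts-left V t = Ts-trans V t (Ts-sym V t)

  Rs-left : ∀ V → Ts Δ V A A → Rs Δ V M M′ A → Rs Δ V M M A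
  Rs-left V t r = Rs-trans V t r (Rs-sym V t r)

  ΠFam-sym V Q q (Πpair a a′ e (t , f)) = Πpair a′ a (≐sym e)
    ( Ts-sym V t
    , λ n r → q (f (≐conv (≐sym n) (≐sym e)) (Rs-sym V (Ts-left V t) (Rs-conv V (Ts-sym V t) r))))

  ΠFam-trans V Q q (Πpair a a′ e (t , f)) (Πpair b b′ e′ (t′ , f′)) with refl ← ⟶*-Π a′ b =
    Πpair a b′ (≐trans e e′)
      ( Ts-trans V t t′
      , λ n r → q (f (≐trans n (≐sym n)) (Rs-left V (Ts-left V t) r)) (f′ (≐conv n e) (Rs-conv V t r)))

  T-sym u         _ = tt
  T-sym π         _ = tt
  T-sym (dom α)   t = t
  T-sym (cod V α) t = t
  T-sym (V ↦ α)   t = ΠFam-sym V (T Δ α) (T-sym α) t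

  T-trans u         _ _  = tt
  T-trans π         _ _  = tt
  T-trans (dom α)   t _  = t
  T-trans (cod V α) t _  = t
  T-trans (V ↦ α)   t t′ = ΠFam-trans V (T Δ α) (T-trans α) t t′

  R-sym u         _ (r , r′) = r′ , r
  R-sym π         _ r = Π≐-sym (λ e f → ≐sym (convert e f)) r
    where
    convert : Δ ⊢ F ≐ F′ ∶ 𝒰 → Δ ▸ F ⊢ G ≐ G′ ∶ 𝒰 → Δ ▸ F′ ⊢ G ≐ G′ ∶ 𝒰
    convert e f = let a , b , _ = presup e in conv-≐ a b e f
  R-sym (dom α)   t r = Π≐-sym (λ _ → R-sym α t) r
  R-sym (cod V α) t r = ΠFam-sym V (λ B B′ → R Δ α B B′ 𝒰) (R-sym α t) r
  R-sym (V ↦ α) (Πpair a a′ e (t , f)) (_ , _ , b , r)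
    with refl ← ⟶*-Π a b | refl ← ⟶*-Π a′ b =
    _ , _ , b , λ n s →
      let s′ = Rs-sym V t s
          g  = f n s
      in R-conv α (T-sym α g) (R-sym α (T-trans α (T-sym α g) g) (r (≐sym n) s′))

  R-trans u         _ (r , _) (_ , r′) = r , r′
  R-trans π         _ r r′ = Π≐-trans
    (λ e f g → let a , b , _ = presup e in ≐trans f (conv-≐ b a (≐sym e) g)) r r′
  R-trans (dom α)   t r r′ = Π≐-trans (λ _ → R-trans α t) r r′
  R-trans (cod V α) t r r′ = ΠFam-trans V (λ B B′ → R Δ α B B′ 𝒰) (R-trans α t) r r′
  R-trans (V ↦ α) (Πpair a a′ e (t , f)) (_ , _ , b , r) (_ , _ , b′ , r′)
    with refl ← ⟶*-Π a b | refl ← ⟶*-Π a′ b | refl ← ⟶*-Π b b′ =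
    _ , _ , b , λ n s →
      -- The intermediate term is `M′ · N`, so the first relation is used with `N` on both sides.
      let m = ≐trans n (≐sym n) ; l = Rs-left V t s
      in R-trans α (f m l) (r m l) (r′ n s)

  R-conv u         _ r = r
  R-conv π         _ r = r
  R-conv (dom α)   _ r = r
  R-conv (cod V α) _ r = r
  R-conv (V ↦ α) (Πpair a a′ e (t , f)) (_ , _ , b , r) with refl ← ⟶*-Π a b =
    _ , _ , a′ , λ n s →
      let m  = ≐conv n (≐sym e)
          s′ = Rs-conv V (Ts-sym V t) s
      in R-conv α (f (≐trans m (≐sym m)) (Rs-left V (Ts-left V t) s′)) (r m s′)

  Ts-sym []      _        = tt
  Ts-sym (v ∷ V) (t , ts) = T-sym v t , Ts-sym V ts

  Ts-trans []      _        _          = tt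
  Ts-trans (v ∷ V) (t , ts) (t′ , ts′) = T-trans v t t′ , Ts-trans V ts ts′

  Rs-sym []      _        _        = tt
  Rs-sym (v ∷ V) (t , ts) (r , rs) = R-sym v t r , Rs-sym V ts rs

  Rs-trans []      _        _        _          = tt
  Rs-trans (v ∷ V) (t , ts) (r , rs) (r′ , rs′) = R-trans v t r r′ , Rs-trans V ts rs rs′

  Rs-conv []      _        _        = tt
  Rs-conv (v ∷ V) (t , ts) (r , rs) = R-conv v t r , Rs-conv V ts rs

  T-left : ∀ α → T Δ α A A′ → T Δ α A A
  T-left α t = T-trans α t (T-sym α t)

  R-left : ∀ α → T Δ α A A → R Δ α M M′ A → R Δ α M M A
  R-left α t r = R-trans α t r (R-sym α t r)

  -- Monotonicity in atoms, expansion, and transport from type information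

  R-≤   : α ≤ β → T Δ α A A → T Δ β A A → R Δ β M M′ A → R Δ α M M′ A
  Rs-⊑  : V ⊑ W → Ts Δ V A A → Ts Δ W A A → Rs Δ W M M′ A → Rs Δ V M M′ A
  R-Any : Any (α ≤_) W → T Δ α A A → Ts Δ W A A → Rs Δ W M M′ A → R Δ α M M′ A

  R-≤ u       _ _ r = r
  R-≤ π       _ _ r = r
  R-≤ (dom p) t t′ (Πpair a a′ e r) = Πpair a a′ e (R-≤ p t t′ r)
  R-≤ (cod p) t t′ (Πpair a a′ e (v , r)) = Πpair a a′ e (v , λ n s → R-≤ p t t′ (r n s))
  -- Arguments are weakened from the larger list to the smaller, and results from the larger atom to
  -- the smaller. In general `T` at neither function atom implies `T` at the other, so both are
  -- assumed.
  R-≤ (fun s p) (Πpair a a′ e (t , f)) (Πpair b b′ _ (t′ , f′)) (_ , _ , c , r)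
    with refl ← ⟶*-Π a c | refl ← ⟶*-Π a′ c | refl ← ⟶*-Π b c | refl ← ⟶*-Π b′ c =
    _ , _ , c , λ n l →
      let l′ = Rs-⊑ s t′ t l
          m  = ≐trans n (≐sym n)
      in R-≤ p (f m (Rs-left _ t l)) (f′ m (Rs-left _ t′ l′)) (r n l′)

  Rs-⊑ []      _        _  _ = tt
  Rs-⊑ (p ∷ s) (t , ts) t′ r = R-Any p t t′ r , Rs-⊑ s ts t′ r

  R-Any (here p)  t (t′ , _) (r , _) = R-≤ p t t′ r
  R-Any (there p) t (_ , t′) (_ , r) = R-Any p t t′ r

  R-expand : ∀ α {N N′} → M ⟶* N → M′ ⟶* N′ → R Δ α N N′ A → R Δ α M M′ A
  R-expand u p q (r , r′) = ⟶*-trans p r , ⟶*-trans q r′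
  R-expand π p q (Πpair a a′ e r) = Πpair (⟶*-trans p a) (⟶*-trans q a′) e r
  R-expand (dom α) p q (Πpair a a′ e r) = Πpair (⟶*-trans p a) (⟶*-trans q a′) e r
  R-expand (cod V α) p q (Πpair a a′ e r) = Πpair (⟶*-trans p a) (⟶*-trans q a′) e r
  R-expand (V ↦ α) p q (_ , _ , a , r) =
    _ , _ , a , λ n s → R-expand α (⟶*-· p) (⟶*-· q) (r n s)

  𝒰-TypeRel : TypeRel Δ (_≡ u) 𝒰 𝒰
  𝒰-TypeRel refl = done , done

  -- Semantic typing is turned into transport: the atoms of the type that `Ty` demands are related
  -- by hypothesis, `dom` atoms giving transport along domains and `cod` atoms along codomains.
  Ty⇒T   : ∀ α → Ty α X → TypeRel Δ X A A′ → T Δ α A A′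
  Tys⇒Ts : ∀ V → Tys V X → TypeRel Δ X A A′ → Ts Δ V A A′

  Ty⇒T u         _       _ = tt
  Ty⇒T π         _       _ = tt
  Ty⇒T (dom α)   (_ , a) _ = Ty⇒T α a 𝒰-TypeRel
  Ty⇒T (cod V α) (_ , a) _ = Ty⇒T α a 𝒰-TypeRel
  Ty⇒T {X = X} {A} {A′} (V ↦ α) (p , v , a) h with h p
  ... | Πpair {F} {F′} {G} {G′} r r′ e _ = Πpair r r′ e
    ( Tys⇒Ts V v (λ x → domain (h x))
    , λ n s → Ty⇒T α a (λ (W , w , x) → codomain n s w (h x)))
    where
    domain : R Δ (dom γ) A A′ 𝒰 → R Δ γ F F′ 𝒰
    domain (Πpair q q′ _ x) with refl ← ⟶*-Π r q | refl ← ⟶*-Π r′ q′ = x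
    codomain : Δ ⊢ N ≐ N′ ∶ F → Rs Δ V N N′ F → W ⊑ V →
               R Δ (cod W γ) A A′ 𝒰 → R Δ γ (G [ N ]) (G′ [ N′ ]) 𝒰
    codomain n s w (Πpair q q′ _ (t , x)) with refl ← ⟶*-Π r q | refl ← ⟶*-Π r′ q′ =
      -- The atom `cod W γ` expects arguments related at `W`; those at hand are related at the
      -- larger `V`.
      x n (Rs-⊑ w (Ts-left _ t) (Ts-left V (Tys⇒Ts V v (λ x → domain (h x)))) s)

  Tys⇒Ts []      _        _ = tt
  Tys⇒Ts (v ∷ V) (a , as) h = Ty⇒T v a h , Tys⇒Ts V as h

-- The fundamental lemma

-- Storing transport in `types` makes symmetry and reflexivity of related substitutions independent
-- of the validity of the declared types.
record Related (Δ : Ctx n) (Γ : Ctx m) (ρ : Env m) (σ τ : Sub m n) : Set where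
  field
    wf     : ⊢ Γ
    models : ρ ⊨ Γ
    subst≐ : ⊢Sub≐ σ τ Γ Δ
    right  : ⊢Sub τ Γ Δ
    types  : ∀ i {α} → ρ i α → T Δ α (sub σ (lookup Γ i)) (sub τ (lookup Γ i))
    terms  : ∀ i {α} → ρ i α → R Δ α (σ i) (τ i) (sub σ (lookup Γ i))
open Related

module _ (Δ : Ctx n) where

  -- Term and substitution vary together, because codomains and function bodies are compared at
  -- distinct related arguments.
  record Valid (Γ : Ctx m) (M N A : Tm m) : Set₁ where
    field
      type : ∀ {ρ σ τ} → Related Δ Γ ρ σ τ → TypeRel Δ (⟦ A ⟧ ρ) (sub σ A) (sub τ A)
      term : ∀ {ρ σ τ} → Related Δ Γ ρ σ τ →
             ∀ {α} → ⟦ M ⟧ ρ α → R Δ α (sub σ M) (sub τ N) (sub σ A)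

  ValidType : (Γ : Ctx m) (A B : Tm m) → Set₁
  ValidType Γ A B = ∀ {ρ σ τ} → Related Δ Γ ρ σ τ → TypeRel Δ (⟦ A ⟧ ρ) (sub σ A) (sub τ B)
open Valid

-- Related substitutions and validity of the rules

module _ {Δ : Ctx n} where

  private
    variable
      σ τ : Sub m n
      A A′ B B′ M M′ N N′ : Tm m

  Related-sym : Related Δ Γ ρ σ τ → Related Δ Γ ρ τ σ
  Related-sym r .wf = r .wf
  Related-sym r .models = r .models
  Related-sym r .subst≐ .left = r .right
  Related-sym r .subst≐ .equal i =
    ≐conv (≐sym (r .subst≐ .equal i)) (sub-fun (r .subst≐) (lookup-⊢ (r .wf) i))
  Related-sym r .right = r .subst≐ .left
  Related-sym r .types i {α} a = T-sym α (r .types i a)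
  Related-sym r .terms i {α} a =
    let t = r .types i a in R-conv α t (R-sym α (T-left α t) (r .terms i a))

  Related-left : Related Δ Γ ρ σ τ → Related Δ Γ ρ σ σ
  Related-left r .wf = r .wf
  Related-left r .models = r .models
  Related-left r .subst≐ .left = r .subst≐ .left
  Related-left r .subst≐ .equal i = ≐refl (sub-lookup (r .subst≐ .left) (r .wf) i)
  Related-left r .right = r .subst≐ .left
  Related-left r .types i {α} a = T-left α (r .types i a)
  Related-left r .terms i {α} a = R-left α (T-left α (r .types i a)) (r .terms i a)

  Related-right : Related Δ Γ ρ σ τ → Related Δ Γ ρ τ τ
  Related-right = Related-left ∘ Related-sym

  Related-≐ : Related Δ Γ ρ σ τ → Γ ⊢ M ≐ N ∶ A → Δ ⊢ sub σ M ≐ sub τ N ∶ sub σ A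
  Related-≐ r e =
    ≐trans (sub-≐ (r .subst≐ .left) e) (sub-fun (r .subst≐) (proj₁ (proj₂ (presup e))))

  Related-tail : Related Δ (Γ ▸ A) ρ σ τ → Related Δ Γ (ρ ∘ suc) (σ ∘ suc) (τ ∘ suc)
  Related-tail {Γ = Γ} {A = A} {ρ = ρ} {σ = σ} {τ = τ} r = record
    { wf     = wf-tail (r .wf)
    ; models = λ i {α} a → Ty-≲ α (⊆⇒≲ (⟦wk⟧⁻ (lookup Γ i) {ρ})) (r .models (suc i) a)
    ; subst≐ = record
      { left  = tail (r .subst≐ .left)
      ; equal = λ i → subst (Δ ⊢ _ ≐ _ ∶_) (sub-wk σ (lookup Γ i)) (r .subst≐ .equal (suc i))
      }
    ; right  = tail (r .right)
    ; types  = λ i {α} a → subst₂ (T Δ α) (sub-wk σ (lookup Γ i)) (sub-wk τ (lookup Γ i)) (r .types (suc i) a)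
    ; terms  = λ i {α} a → subst (R Δ α _ _) (sub-wk σ (lookup Γ i)) (r .terms (suc i) a)
    }
    where
    wf-tail : ⊢ Γ ▸ A → ⊢ Γ
    wf-tail (⊢▸ d _) = d
    tail : ∀ {υ} → ⊢Sub υ (Γ ▸ A) Δ → ⊢Sub (υ ∘ suc) Γ Δ
    tail {υ} s = base (sub-ctx s (r .wf)) λ i →
      subst (Δ ⊢ _ ∶_) (sub-wk υ (lookup Γ i)) (sub-lookup s (r .wf) (suc i))

  Valid-𝒰 : ValidType Δ Γ A B → Valid Δ Γ A B 𝒰
  Valid-𝒰 v .type _ = 𝒰-TypeRel
  Valid-𝒰 v .term r = v r

  Related-▹ : Related Δ Γ ρ σ τ → Γ ⊢ A ∶ 𝒰 → ValidType Δ Γ A A →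
              (∀ {α} → X α → Ty α (⟦ A ⟧ ρ)) →
              Δ ⊢ N ≐ N′ ∶ sub σ A → (∀ {α} → X α → R Δ α N N′ (sub σ A)) →
              Related Δ (Γ ▸ A) (ρ ,, X) (σ ▹ N) (τ ▹ N′)
  Related-▹ {Γ = Γ} {σ = σ} {τ = τ} {A = A} r d v t e x = record
    { wf     = ⊢▸ (r .wf) d
    ; models = ⊨-,, {A = A} (r .models) t
    ; subst≐ = ▹-≐ (r .subst≐) (r .wf) (proj₁ (presup e)) e
    ; right  = ▹-⊢ (r .right) (r .wf) (⊢conv (proj₁ (proj₂ (presup e))) (sub-fun (r .subst≐) d))
    ; types  = λ
      { zero {α} a → subst₂ (T Δ α) (sym (sub-wk _ A)) (sym (sub-wk _ A)) (Ty⇒T α (t a) (v r))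
      ; (suc i) {α} a → subst₂ (T Δ α) (sym (sub-wk _ (lookup Γ i))) (sym (sub-wk _ (lookup Γ i)))
                               (r .types i a) }
    ; terms  = λ
      { zero {α} a → subst (R Δ α _ _) (sym (sub-wk _ A)) (x a)
      ; (suc i) {α} a → subst (R Δ α _ _) (sym (sub-wk _ (lookup Γ i))) (r .terms i a) }
    }

  Related-▹-∈ : Related Δ Γ ρ σ τ → Γ ⊢ A ∶ 𝒰 → ValidType Δ Γ A A → Tys V (⟦ A ⟧ ρ) →
                Δ ⊢ N ≐ N′ ∶ sub σ A → Rs Δ V N N′ (sub σ A) →
                Related Δ (Γ ▸ A) (ρ ,, (_∈ V)) (σ ▹ N) (τ ▹ N′)
  Related-▹-∈ r d v t e x = Related-▹ r d v (Tys-lookup t) e (Rs-lookup x)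

  type-T : ValidType Δ Γ A A → Γ ⊢ M′ ∶ A → Related Δ Γ ρ σ τ →
           ⟦ M′ ⟧ ρ α → T Δ α (sub σ A) (sub τ A)
  type-T {α = α} v d r a = Ty⇒T α (sound-Ty d (r .models) a) (v r)

  -- An atom of `N` is only below an atom of `M`. Validity is applied to the latter with the
  -- substitutions swapped, and `R-≤` descends to the former.
  Valid-sym : Γ ⊢ M ≐ N ∶ A → Valid Δ Γ M N A → Valid Δ Γ N M A
  Valid-sym e v .type = v .type
  Valid-sym e v .term r {α} a =
    let d , d′ , _ = presup e
        β , p , b = proj₂ (sound-≈ e (r .models)) a
        t = type-T (v .type) d′ r a
        s = type-T (v .type) d r b
    in R-≤ p (T-left α t) (T-left β s)
         (R-sym β (T-left β s) (R-conv β (T-sym β s) (v .term (Related-sym r) b)))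

  -- Both `sub σ M` and `sub τ M` are related to `sub τ N`.
  Valid-left : Γ ⊢ M ≐ N ∶ A → Valid Δ Γ M N A → Valid Δ Γ M M A
  Valid-left e v .type = v .type
  Valid-left e v .term r {α} a =
    let t = type-T (v .type) (proj₁ (presup e)) r a
    in R-trans α (T-left α t) (v .term r a)
         (R-sym α (T-left α t) (R-conv α (T-sym α t) (v .term (Related-right r) a)))

  Valid-trans : Γ ⊢ M ≐ N ∶ A → Γ ⊢ N ≐ N′ ∶ A → Valid Δ Γ M N A → Valid Δ Γ N N′ A → Valid Δ Γ M N′ A
  Valid-trans e f v w .type = v .type
  Valid-trans e f v w .term r {α} a =
    let β , p , b = proj₁ (sound-≈ e (r .models)) a
        t = T-left α (type-T (v .type) (proj₁ (presup e)) r a)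
        s = T-left β (type-T (v .type) (proj₁ (presup f)) r b)
    in R-trans α t (v .term (Related-left r) a) (R-≤ p t s (w .term r b))

  Valid-conv : Γ ⊢ M ≐ N ∶ A → Γ ⊢ A ≐ B ∶ 𝒰 → Valid Δ Γ M N A → Valid Δ Γ A B 𝒰 → Valid Δ Γ M N B
  Valid-conv e f v w .type = Valid-left (≐sym f) (Valid-sym f w) .term
  Valid-conv e f v w .term r {α} a =
    -- `R` is typed on the left, so transport goes from `sub σ A` to `sub σ B`, with `σ` on both
    -- sides.
    R-conv α (Ty⇒T α (sound-Ty (proj₁ (presup e)) (r .models) a) (w .term (Related-left r)))
      (v .term r a)

  Valid-Π : Γ ⊢ A ≐ A′ ∶ 𝒰 → Γ ▸ A ⊢ B ≐ B′ ∶ 𝒰 →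
            ValidType Δ Γ A A′ → ValidType Δ (Γ ▸ A) B B′ → ValidType Δ Γ (Π A B) (Π A′ B′)
  Valid-Π {A = A} {A′ = A′} {B = B} {B′ = B′} e f v w {ρ} {σ} {τ} r = go
    where
    vA = Valid-left e (Valid-𝒰 v) .term
    dA = proj₁ (presup e)
    pair : ∀ {P} → P _ _ _ _ → Π≐ Δ P (sub σ (Π A B)) (sub τ (Π A′ B′))
    pair = Πpair done done (Related-≐ r e)
    go : TypeRel Δ (⟦ Π A B ⟧ ρ) (sub σ (Π A B)) (sub τ (Π A′ B′))
    go {π} _ = pair
      (≐trans (sub-≐ (lift (r .subst≐ .left)) f)
              (sub-fun (lift-≐ (r .subst≐) dA) (proj₁ (proj₂ (presup f)))))
    go {dom α} a = pair (v r a)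
    go {cod V α} (t , a) = pair
      ( Tys⇒Ts V t (v r)
      , λ n s → subst₂ (λ C D → R Δ α C D 𝒰) (sym (sub-▹ σ B _)) (sym (sub-▹ τ B′ _))
                  (w (Related-▹-∈ r dA vA t n s) a))

  Valid-ƛ : Γ ⊢ A ≐ A′ ∶ 𝒰 → Γ ▸ A ⊢ M ≐ M′ ∶ B →
            ValidType Δ Γ A A′ → Valid Δ (Γ ▸ A) M M′ B → Valid Δ Γ (ƛ A M) (ƛ A′ M′) (Π A B)
  Valid-ƛ {A = A} e f v w .type =
    let d = proj₁ (presup e) in
    Valid-Π (≐refl d) (≐refl (proj₂ (proj₂ (presup f)))) (Valid-left e (Valid-𝒰 v) .term) (w .type)
  Valid-ƛ {M = M} {M′ = M′} {B = B} e f v w .term {σ = σ} {τ} r {V ↦ α} (t , a) =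
    _ , _ , done , λ n s →
      R-expand α (⟶β ◅ done) (⟶β ◅ done)
        (subst₂ (λ X Y → R Δ α X Y _) (sym (sub-▹ σ M _)) (sym (sub-▹ τ M′ _))
          (subst (R Δ α _ _) (sym (sub-▹ σ B _))
            (w .term (Related-▹-∈ r (proj₁ (presup e)) (Valid-left e (Valid-𝒰 v) .term) t n s) a)))

  Rs-◂ : Γ ⊢ N ∶ A → Valid Δ Γ N N′ A → Related Δ Γ ρ σ τ → Tys V (⟦ A ⟧ ρ) → V ◂ ⟦ N ⟧ ρ →
         Rs Δ V (sub σ N) (sub τ N′) (sub σ A)
  Rs-◂ {V = V} d w r t v = Rs-tabulate V λ {x} i →
    let β , p , b = All.lookup v i
    in R-≤ p (T-left x (Ty⇒T x (Tys-lookup t i) (w .type r))) (T-left β (type-T (w .type) d r b)) (w .term r b)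

  Valid-· : Γ ⊢ M ≐ M′ ∶ Π A B → Γ ⊢ N ≐ N′ ∶ A →
            Valid Δ Γ M M′ (Π A B) → Valid Δ Γ N N′ A → Valid Δ Γ (M · N) (M′ · N′) (B [ N ])
  Valid-· {B = B} {N = N} e f v w .type {ρ} {σ} {τ} r {γ} a
    -- By continuity an atom `γ` of `B [ N ]` uses finitely many atoms `V` of `N`. Then `cod V γ` is
    -- an atom of `Π A B`, whose validity is known.
    with ⟦⟧-cont B (⟦[]⟧⁻ B N a)
  ... | V , x , b with v .type r {cod V γ} (Tys-tabulate V (λ i → sound-Ty d (r .models) (All.lookup x i)) , b)
    where d = proj₁ (presup f)
  ... | Πpair q q′ _ (_ , h) with refl ← ⟶*-Π done q | refl ← ⟶*-Π done q′ =
    subst₂ (λ C D → R Δ γ C D 𝒰) (sym (sub-[] σ B N)) (sym (sub-[] τ B N))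
      (h (Related-≐ r (≐refl d)) (Rs-◂ d (Valid-left f w) r
        (Tys-tabulate V (λ i → sound-Ty d (r .models) (All.lookup x i))) (All⇒◂ x)))
    where d = proj₁ (presup f)
  Valid-· {B = B} {N = N} e f v w .term {σ = σ} r {α} (V , a , x) with v .term r a
  ... | _ , _ , q , h with refl ← ⟶*-Π done q =
    let _ , t , _ = sound-Ty (proj₁ (presup e)) (r .models) a in
    subst (R Δ α _ _) (sym (sub-[] σ B N)) (h (Related-≐ r f) (Rs-◂ (proj₁ (presup f)) w r t x))

  Valid-β : Γ ⊢ A ∶ 𝒰 → Γ ▸ A ⊢ M ∶ B → Γ ⊢ N ∶ A →
            ValidType Δ Γ A A → Valid Δ (Γ ▸ A) M M B → Valid Δ Γ N N A →
            Valid Δ Γ (ƛ A M · N) (M [ N ]) (B [ N ])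
  Valid-β {Γ = Γ} {A = A} {M = M} {B = B} {N = N} dA dM dN v w x = go
    where
    -- The new variable receives all atoms of `N`, so that atoms of `B [ N ]` become atoms of `B`;
    -- the finite `V` of the redex is enlarged to them by `⟦⟧-◂`.
    extend : Related Δ Γ ρ σ τ → Related Δ (Γ ▸ A) (ρ ,, ⟦ N ⟧ ρ) (σ ▹ sub σ N) (τ ▹ sub τ N)
    extend r = Related-▹ r dA v (sound-Ty dN (r .models)) (Related-≐ r (≐refl dN)) (x .term r)
    ty : ValidType Δ Γ (B [ N ]) (B [ N ])
    ty {σ = σ} {τ} r {γ} a =
      subst₂ (λ C D → R Δ γ C D 𝒰) (sym (sub-[]-▹ σ B N)) (sym (sub-[]-▹ τ B N))
        (w .type (extend r) (⟦[]⟧⁻ B N a))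
    go : Valid Δ Γ (ƛ A M · N) (M [ N ]) (B [ N ])
    go .type = ty
    go .term {σ = σ} {τ} r {α} c@(V , (_ , a) , y) =
      let β , p , b = ⟦⟧-◂ M y a
      in R-expand α (⟶β ◅ done) done
           (R-≤ p (T-left α (type-T ty (⊢· (⊢ƛ dA dM) dN) r c))
                  (T-left β (type-T ty ([]-⊢ dM dN) r (⟦[]⟧⁺ M N b)))
             (subst₂ (λ X Y → R Δ β X Y _) (sym (sub-▹ σ M (sub σ N))) (sym (sub-[]-▹ τ M N))
               (subst (R Δ β _ _) (sym (sub-[]-▹ σ B N)) (w .term (extend r) b))))

  Valid-dom : ValidType Δ Γ (Π A B) (Π A B) → ValidType Δ Γ A A
  Valid-dom v r {γ} a with v r {dom γ} a
  ... | Πpair q q′ _ b with refl ← ⟶*-Π done q | refl ← ⟶*-Π done q′ = b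

  Valid-η : Γ ⊢ M ∶ Π A B → ValidType Δ Γ (Π A B) (Π A B) →
            Valid Δ (Γ ▸ A) (wk M · var zero) (wk N · var zero) B → Valid Δ Γ M N (Π A B)
  Valid-η d p w .type = p
  Valid-η d p w .term r {u}       a = ⊥-elim (sound-Ty d (r .models) a)
  Valid-η d p w .term r {π}       a = ⊥-elim (sound-Ty d (r .models) a)
  Valid-η d p w .term r {dom _}   a = ⊥-elim (proj₁ (sound-Ty d (r .models) a))
  Valid-η d p w .term r {cod _ _} a = ⊥-elim (proj₁ (sound-Ty d (r .models) a))
  Valid-η {M = M} {B = B} {N = N} d p w .term {σ = σ} {τ} r {V ↦ α} a =
    _ , _ , done , λ n s →
      -- When the new variable has the atoms `V`, the atom `V ↦ α` of `M` makes `α` an atom of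
      -- `wk M · var zero`; the given arguments are then substituted for that variable.
      let _ , t , _ = sound-Ty d (r .models) a in
      subst₂ (λ X Y → R Δ α (X · _) (Y · _) _) (sub-wk _ M) (sub-wk _ N)
        (subst (R Δ α _ _) (sym (sub-▹ σ B _))
          (w .term (Related-▹-∈ r (proj₁ (Π-inv (type-⊢ d))) (Valid-dom {B = B} p) t n s) (V , ⟦wk⟧⁺ M a , All⇒◂ (All.tabulate id))))

  -- A declared type depends only on earlier variables, so related substitutions are restricted to
  -- the prefix; the recursion uses the context derivation inside `⊢var`.
  valid-lookup : ⊢ Γ → ∀ i → ValidType Δ Γ (lookup Γ i) (lookup Γ i)
  valid-⊢      : Γ ⊢ M ∶ A → Valid Δ Γ M M A
  valid-≐      : Γ ⊢ M ≐ N ∶ A → Valid Δ Γ M N A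

  valid-lookup (⊢▸ {A = A} d e) zero {ρ} {σ} {τ} r {γ} a =
    subst₂ (λ C D → R Δ γ C D 𝒰) (sym (sub-wk σ A)) (sym (sub-wk τ A))
      (valid-⊢ e .term (Related-tail r) (⟦wk⟧⁻ A {ρ} a))
  valid-lookup {Γ = Γ ▸ _} (⊢▸ d e) (suc i) {ρ} {σ} {τ} r {γ} a =
    subst₂ (λ C D → R Δ γ C D 𝒰) (sym (sub-wk σ (lookup Γ i))) (sym (sub-wk τ (lookup Γ i)))
      (valid-lookup d i (Related-tail r) (⟦wk⟧⁻ (lookup Γ i) {ρ} a))

  valid-⊢ (⊢var d i) .type = valid-lookup d i
  valid-⊢ (⊢var d i) .term r = r .terms i
  valid-⊢ (⊢𝒰 d) = Valid-𝒰 (λ _ → 𝒰-TypeRel)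
  valid-⊢ (⊢Π a b) =
    Valid-𝒰 (Valid-Π (≐refl a) (≐refl b) (valid-⊢ a .term) (valid-⊢ b .term))
  valid-⊢ (⊢ƛ a b) = Valid-ƛ (≐refl a) (≐refl b) (valid-⊢ a .term) (valid-⊢ b)
  valid-⊢ (⊢· a b) = Valid-· (≐refl a) (≐refl b) (valid-⊢ a) (valid-⊢ b)
  valid-⊢ (⊢conv d e) = Valid-conv (≐refl d) e (valid-⊢ d) (valid-≐ e)

  valid-≐ (≐refl d) = valid-⊢ d
  valid-≐ (≐sym e) = Valid-sym e (valid-≐ e)
  valid-≐ (≐trans e f) = Valid-trans e f (valid-≐ e) (valid-≐ f)
  valid-≐ (≐conv e f) = Valid-conv e f (valid-≐ e) (valid-≐ f)
  valid-≐ (≐Π e f) = Valid-𝒰 (Valid-Π e f (valid-≐ e .term) (valid-≐ f .term))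
  valid-≐ (≐ƛ e f) = Valid-ƛ e f (valid-≐ e .term) (valid-≐ f)
  valid-≐ (≐· e f) = Valid-· e f (valid-≐ e) (valid-≐ f)
  valid-≐ (≐β a b c) = Valid-β a b c (valid-⊢ a .term) (valid-⊢ b) (valid-⊢ c)
  valid-≐ (≐η a b e) = Valid-η a (valid-⊢ a .type) (valid-≐ e)

-- The identity substitution and injectivity of `Π`

Related-id : ⊢ Γ → Related Γ Γ (λ _ _ → ⊥) var var
Related-id d .wf = d
Related-id d .models i ()
Related-id d .subst≐ .left = id-⊢ d
Related-id d .subst≐ .equal i = ≐refl (sub-lookup (id-⊢ d) d i)
Related-id d .right = id-⊢ d
Related-id d .types i ()
Related-id d .terms i ()

corollary2p37 : ∀ {n : ℕ} {Γ : Ctx n} {A A′ B B′} → Γ ⊢ Π A B ≐ Π A′ B′ ∶ 𝒰 → (Γ ⊢ A ≐ A′ ∶ 𝒰) × (Γ ▸ A ⊢ B ≐ B′ ∶ 𝒰)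
corollary2p37 {Γ = Γ} {A} {A′} {B} {B′} e
  with subst₂ (λ X Y → R Γ π X Y 𝒰) (sub-var (λ _ → refl) (Π A B)) (sub-var (λ _ → refl) (Π A′ B′))
         (valid-≐ e .term (Related-id (ctx≐ e)) {π} tt)
-- Both Π-types are weak head normal, so the components provided by the relation are the given ones.
... | Πpair q q′ dom≐ cod≐ with refl ← ⟶*-Π done q | refl ← ⟶*-Π done q′ = dom≐ , cod≐
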